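{- Let $\sigma$ be a fixed finite vocabulary and let $\mathcal{C}$ be a class of finite ordered $\sigma$-structures. Then $\mathcal{C}$ is decidable by a random-access Turing machine working in polylogarithmic space with respect to $\hat n$ if and only if $\mathcal{C}$ is decidable by a standard (sequential-access) Turing machine in polylogarithmic space with respect to $\hat n$, where $\hat n=|\mathrm{bin}(\mathbf{A})|$ is the size of the binary encoding of the input structure $\mathbf{A}$.
   Context: **Structures.** A finite vocabulary $\sigma=\{R_1^{r_1},\dots,R_p^{r_p},c_1,\dots,c_q,f_1^{k_1},\dots,f_s^{k_s}\}$ consists of relation symbols ($R_i$ of arity $r_i$), constant symbols and function symbols ($f_i$ of arity $k_i$, interpreted by total functions). A finite ordered $\sigma$-structure $\mathbf{A}$ is a finite structure of vocabulary $\sigma\cup\{\le\}$, $\le\,\notin\sigma$, with $\le^{\mathbf{A}}$ a linear order on $A$. One assumes the domain is $A=\{0,\dots,n-1\}$ with its natural order. $\log$ is the binary logarithm. **Encoding.** $\mathrm{bin}(\mathbf{A})$ is the concatenation of the following binary strings, for all relations, then all constants, then all functions in $\sigma$: each relation $R_i^{\mathbf{A}}$ is encoded by a string of length $n^{r_i}$ whose $m$-th bit is $1$ iff the $m$-th tuple of $A^{r_i}$ (in lexicographic order) is in $R_i^{\mathbf{A}}$; each constant is encoded by its binary representation of length $\lceil\log n\rceil$; each function $f_i^{\mathbf{A}}$ is encoded by the encodings of $\lceil\log n\rceil$ many $k_i$-ary relations, the $m$-th of which indicates whether the $m$-th bit of the value of the function is $1$. (The order $\le^{\mathbf{A}}$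 is not encoded explicitly.) **Random-access Turing machine.** A deterministic multi-tape machine $(Q,\Sigma,\delta,q_0,F)$ with $\Sigma=\{0,1,\sqcup\}$, a finite state set $Q$, initial state $q_0$, accepting states $F\subseteq Q$, a read-only random-access input-tape, a sequential-access address-tape (over $\{0,1,\sqcup\}$), and a fixed number $k\ge 1$ of sequential-access work-tapes; all tapes have a leftmost cell and are infinite to the right, and a head on the leftmost cell may not move left. The (partial) transition function is $\delta: Q\times(\Sigma\cup\{\triangleleft\})\times\Sigma^{k+1}\to Q\times(\Sigma\times\{\leftarrow,\rightarrow,-\})^{k+1}$: depending on the state, the scanned input symbol and the symbols scanned on the address-tape and work-tapes, it gives the new state and the symbols written and head moves on the address-tape and work-tapes. The machine halts when $\delta$ is undefined. If the number written in binary (most significant bit leftmost) on the address-tape from its leftmost cell up to the first blank is $i$ (with $i=0$ if the leftmost cell is blank), then the scanned input symbol is the $(i+1)$-th symbol of the input string if $i$ is less than its length, and the end-marker $\triangleleft$ otherwise. Initially the state is $q_0$, the address-tape contains $0$, the work-tapes are blank and all sequential heads are on the leftmost cells. An input is accepted if a configuration with state in $F$ is reached. **Standard (sequential-access) Turing machine.** Defined as the random-access Turing machine, except that there is no address-tape, and the read-only input-tape (holding the input string followed by the end-marker $\triangleleft$) is scanned by a sequential-access two-way read-only head, starting on the leftmost cell, whose moves (left, right, stay) are given by the transition function. **Deciding in polylogarithmic space.** A machine $M$ of either kind decides $\mathcal{C}$ in polylogarithmic space with respect to $\hat n$ if there is $k\in\mathbb{N}$ such that, for every finite ordered $\sigma$-structure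 $\mathbf{A}$, on input $\mathrm{bin}(\mathbf{A})$ the machine visits $O(\lceil\log\hat n\rceil^k)$ cells in each work-tape (including the address-tape, if present; the read-only input-tape is not counted) before accepting or rejecting, it always accepts or rejects, and it accepts iff $\mathbf{A}\in\mathcal{C}$. -}

module Defs where

open import Data.Bool using (Bool; true; false; T)
open import Data.Fin using (Fin; toℕ)
open import Data.List using (List; []; _∷_; _++_; map; concatMap; length; lookup; allFin; cartesianProductWith; _ʳ++_)
open import Data.List.Relation.Unary.All using (All)
open import Data.Maybe using (Maybe; just; nothing)
import Data.Maybe as Maybe
open import Data.Nat using (ℕ; zero; suc; pred; _+_; _*_; _^_; _≤_; _<_; _≥_; _≡ᵇ_; _/_; _%_; NonZero)
open import Data.Nat.Logarithm using (⌈log₂_⌉)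
open import Data.Product using (∃-syntax; _×_; _,_)
open import Data.Sum using (_⊎_)
open import Data.Vec using (Vec; []; _∷_; _∷ʳ_)
import Data.Vec as Vec
open import Function using (_↔_; _⇔_)
open import Level using (Level)
open import Relation.Binary using (Rel)
open import Relation.Binary.Construct.Closure.ReflexiveTransitive using (Star)
open import Relation.Binary.PropositionalEquality using (_≡_)
open import Relation.Nullary using (¬_)
open import Relation.Unary using (Pred; _∈_)

------------------------------------------------------------------------
-- Finite ordered structures

-- Relation and function symbols are listed by their arities.
record Vocabulary : Set where
  field
    relations : List ℕ
    constants : ℕ
    functions : List ℕ

-- The domain {0, …, n-1} is Fin size; the linear order is the natural
-- order of Fin size, so it is not a field.
record OrderedStructure (σ : Vocabulary) : Set where
  open Vocabulary σ
  field
    size         : ℕ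
    .{{nonEmpty}} : NonZero size
    rel          : (i : Fin (length relations)) → Vec (Fin size) (lookup relations i) → Bool
    const        : Fin constants → Fin size
    fun          : (i : Fin (length functions)) → Vec (Fin size) (lookup functions i) → Fin size

------------------------------------------------------------------------
-- Binary encoding

-- All r-tuples over Fin n, in lexicographic order.
tuples : (n r : ℕ) → List (Vec (Fin n) r)
tuples n zero    = [] ∷ []
tuples n (suc r) = cartesianProductWith _∷_ (allFin n) (tuples n r)

-- The l low-order bits of v, most significant bit first.
binary : (l v : ℕ) → Vec Bool l
binary zero    v = []
binary (suc l) v = binary l (v / 2) ∷ʳ (v % 2 ≡ᵇ 1)

module _ {n : ℕ} where

  encodeRelation : ∀ {r} → (Vec (Fin n) r → Bool) → List Bool
  encodeRelation {r} R = map R (tuples n r)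

  encodeConstant : Fin n → List Bool
  encodeConstant a = Vec.toList (binary ⌈log₂ n ⌉ (toℕ a))

  encodeFunction : ∀ {r} → (Vec (Fin n) r → Fin n) → List Bool
  encodeFunction f =
    concatMap (λ m → encodeRelation (λ t → Vec.lookup (binary ⌈log₂ n ⌉ (toℕ (f t))) m))
              (allFin ⌈log₂ n ⌉)

bin : ∀ {σ} → OrderedStructure σ → List Bool
bin {σ} 𝐀 =
     concatMap (λ i → encodeRelation (rel i))   (allFin (length relations))
  ++ concatMap (λ i → encodeConstant (const i)) (allFin constants)
  ++ concatMap (λ i → encodeFunction (fun i))   (allFin (length functions))
  where
  open Vocabulary σ
  open OrderedStructure 𝐀

n̂ : ∀ {σ} → OrderedStructure σ → ℕ
n̂ 𝐀 = length (bin 𝐀)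

------------------------------------------------------------------------
-- Tapes

data Symbol : Set where
  𝟘 𝟙 ␣ : Symbol

data InputSymbol : Set where
  ⌞_⌟ : Symbol → InputSymbol
  ◁   : InputSymbol

bit : Bool → Symbol
bit false = 𝟘
bit true  = 𝟙

data Move : Set where
  left right stay : Move

-- A one-way infinite tape: `before` holds the cells to the left of the
-- head, nearest first, and all cells to the right of `after` are blank.
record Tape : Set where
  constructor tape
  field
    before  : List Symbol
    scanned : Symbol
    after   : List Symbol

  -- Distance of the head from the leftmost cell.
  position : ℕ
  position = length before

  contents : List Symbol
  contents = before ʳ++ scanned ∷ after

blankTape : Tape
blankTape = tape [] ␣ []

-- A left move on the leftmost cell leaves the head where it is.
moveHead : Move → Tape → Tape
moveHead left  (tape []       s r)       = tape [] s r
moveHead left  (tape (x ∷ l)  s r)       = tape l x (s ∷ r)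
moveHead right (tape l        s [])      = tape (s ∷ l) ␣ []
moveHead right (tape l        s (x ∷ r)) = tape (s ∷ l) x r
moveHead stay  t                         = t

act : Symbol × Move → Tape → Tape
act (s , m) (tape l _ r) = moveHead m (tape l s r)

actAll : ∀ {k} → Vec (Symbol × Move) k → Vec Tape k → Vec Tape k
actAll = Vec.zipWith act

scan : ∀ {k} → Vec Tape k → Vec Symbol k
scan = Vec.map Tape.scanned

------------------------------------------------------------------------
-- Deterministic computations and the space they use

record Computation : Set₁ where
  field
    Config        : Set
    start         : Config
    step          : Config → Maybe Config
    accepting     : Config → Bool
    -- Head positions on the tapes whose space is counted.
    headPositions : Config → List ℕ

module _ (P : Computation) where
  open Computation P

  _⟶_ : Rel Config _
  c ⟶ c′ = step c ≡ just c′

  -- A step of the computation before it has accepted.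
  _⟶°_ : Rel Config _
  c ⟶° c′ = ¬ T (accepting c) × c ⟶ c′

  Accepts : Set
  Accepts = ∃[ c ] Star _⟶_ start c × T (accepting c)

  Halts : Set
  Halts = ∃[ c ] Star _⟶_ start c × step c ≡ nothing

  Rejects : Set
  Rejects = Halts × ¬ Accepts

  -- Heads start on the leftmost cell and move by at most one cell, so at
  -- most b cells of a tape are visited iff the head position stays below b.
  VisitsAtMost : ℕ → Set
  VisitsAtMost b = ∀ {c} → Star _⟶°_ start c → All (_< b) (headPositions c)

------------------------------------------------------------------------
-- Random-access Turing machines

readFrom : ℕ → List Symbol → ℕ
readFrom acc []      = acc
readFrom acc (𝟘 ∷ s) = readFrom (2 * acc) s
readFrom acc (𝟙 ∷ s) = readFrom (2 * acc + 1) s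
readFrom acc (␣ ∷ s) = acc

-- The number written in binary up to the first blank.
readBinary : List Symbol → ℕ
readBinary = readFrom 0

randomAccess : List Bool → ℕ → InputSymbol
randomAccess []      i       = ◁
randomAccess (b ∷ w) zero    = ⌞ bit b ⌟
randomAccess (b ∷ w) (suc i) = randomAccess w i

record RandomAccessTM : Set₁ where
  field
    Q      : Set
    finite : ∃[ m ] (Q ↔ Fin m)
    q₀     : Q
    F      : Q → Bool
    k      : ℕ
    k≥1    : k ≥ 1
    -- The first of the suc k tapes is the address-tape.
    δ      : Q → InputSymbol → Vec Symbol (suc k) → Maybe (Q × Vec (Symbol × Move) (suc k))

  record Configuration : Set where
    eta-equality
    constructor config
    field
      state : Q
      tapes : Vec Tape (suc k)

  initial : Configuration
  initial = config q₀ (tape [] 𝟘 [] ∷ Vec.replicate k blankTape)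

  scannedInput : List Bool → Vec Tape (suc k) → InputSymbol
  scannedInput w (address ∷ _) = randomAccess w (readBinary (Tape.contents address))

  perform : Vec Tape (suc k) → Q × Vec (Symbol × Move) (suc k) → Configuration
  perform ts (q′ , as) = config q′ (actAll as ts)

  next : List Bool → Configuration → Maybe Configuration
  next w (config q ts) = Maybe.map (perform ts) (δ q (scannedInput w ts) (scan ts))

  run : List Bool → Computation
  run w = record
    { Config        = Configuration
    ; start         = initial
    ; step          = next w
    ; accepting     = λ c → F (Configuration.state c)
    ; headPositions = λ c → Vec.toList (Vec.map Tape.position (Configuration.tapes c))
    }

------------------------------------------------------------------------
-- Standard (sequential-access) Turing machines

-- The input-tape holds the input string, then ◁, then blanks; it is
-- infinite to the right and the head may move beyond ◁.
inputCell : List Bool → ℕ → InputSymbol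
inputCell []      zero    = ◁
inputCell []      (suc i) = ⌞ ␣ ⌟
inputCell (b ∷ w) zero    = ⌞ bit b ⌟
inputCell (b ∷ w) (suc i) = inputCell w i

moveInput : Move → ℕ → ℕ
moveInput left  i = pred i
moveInput right i = suc i
moveInput stay  i = i

record StandardTM : Set₁ where
  field
    Q      : Set
    finite : ∃[ m ] (Q ↔ Fin m)
    q₀     : Q
    F      : Q → Bool
    k      : ℕ
    k≥1    : k ≥ 1
    δ      : Q → InputSymbol → Vec Symbol k → Maybe (Q × Move × Vec (Symbol × Move) k)

  record Configuration : Set where
    eta-equality
    constructor config
    field
      state     : Q
      inputHead : ℕ
      tapes     : Vec Tape k

  initial : Configuration
  initial = config q₀ 0 (Vec.replicate k blankTape)

  perform : ℕ → Vec Tape k → Q × Move × Vec (Symbol × Move) k → Configuration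
  perform i ts (q′ , m , as) = config q′ (moveInput m i) (actAll as ts)

  next : List Bool → Configuration → Maybe Configuration
  next w (config q i ts) = Maybe.map (perform i ts) (δ q (inputCell w i) (scan ts))

  run : List Bool → Computation
  run w = record
    { Config        = Configuration
    ; start         = initial
    ; step          = next w
    ; accepting     = λ c → F (Configuration.state c)
    ; headPositions = λ c → Vec.toList (Vec.map Tape.position (Configuration.tapes c))
    }

------------------------------------------------------------------------
-- Deciding a class of structures in polylogarithmic space

module _ {σ : Vocabulary} {ℓ : Level} where

  record DecidesInPolylogSpace (run : List Bool → Computation)
                               (𝒞 : Pred (OrderedStructure σ) ℓ) : Set ℓ where
    field
      -- O(⌈log n̂⌉ᵏ): bounded by c · ⌈log n̂⌉ᵏ for all sufficiently large n̂.
      space   : ∃[ k ] ∃[ c ] ∃[ N ] (∀ (𝐀 : OrderedStructure σ) → N ≤ n̂ 𝐀 →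
                  VisitsAtMost (run (bin 𝐀)) (c * ⌈log₂ n̂ 𝐀 ⌉ ^ k))
      total   : ∀ (𝐀 : OrderedStructure σ) → Accepts (run (bin 𝐀)) ⊎ Rejects (run (bin 𝐀))
      correct : ∀ (𝐀 : OrderedStructure σ) → Accepts (run (bin 𝐀)) ⇔ 𝐀 ∈ 𝒞

  RandomAccessDecidable : Pred (OrderedStructure σ) ℓ → Set _
  RandomAccessDecidable 𝒞 = ∃[ M ] DecidesInPolylogSpace (RandomAccessTM.run M) 𝒞

  StandardDecidable : Pred (OrderedStructure σ) ℓ → Set _
  StandardDecidable 𝒞 = ∃[ M ] DecidesInPolylogSpace (StandardTM.run M) 𝒞

{-# OPTIONS --safe #-}
module Submission where

-- A random-access machine is simulated by copying the address to a scratch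
-- counter and counting it down while the input head moves to the right.
-- Conversely, the position of a sequential input head is kept in binary on the
-- address-tape, with a second counter for its distance beyond the end-marker.
-- That distance is not bounded by the input; but where only blanks are read the
-- machine cannot sense it, so by the pigeonhole principle a halting run stays
-- within as many cells beyond the end-marker as there are combinations of state
-- and work-tape contents, which is exponential in the space used.

open import Defs
open import Data.Bool using (Bool; true; false; T; if_then_else_)
open import Data.Empty using (⊥)
open import Data.Fin using (Fin; zero; suc; toℕ; combine; inject≤)
import Data.Fin as Fin
open import Data.Fin.Properties
  using (+↔⊎; *↔×; 2↔Bool; combine-injective; pigeonhole; toℕ-inject≤; toℕ≤pred[n])
open import Data.List using (List; []; _∷_; [_]; length; map; drop; reverse; _++_; _ʳ++_)
open import Data.List.Properties
  using (length-map; length-++; map-∘; map-++; map-ʳ++; ∷-injective; ʳ++-defn; ++-assoc; ++-identityʳ; reverse-involutive)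
open import Data.List.Relation.Unary.All as All using (All; []; _∷_)
open import Data.Maybe as Maybe using (Maybe; just; nothing)
open import Data.Maybe.Properties using (just-injective)
open import Data.Nat
open import Data.Nat.Induction using (<-rec)
open import Data.Nat.Logarithm using (⌈log₂_⌉; ⌈log₂⌉-mono-≤; ⌈log₂2^n⌉≡n; ⌈log₂⌈n/2⌉⌉≡⌈log₂n⌉∸1)
open import Data.Nat.Properties
open import Data.Nat.Tactic.RingSolver using (solve-∀)
open import Data.Product hiding (map; zip)
open import Data.Product.Function.NonDependent.Propositional using (_×-↔_)
open import Data.Sum using (_⊎_; inj₁; inj₂)
open import Data.Sum.Function.Propositional using (_⊎-↔_)
open import Data.Unit using (⊤; tt)
open import Data.Vec as Vec using (Vec; []; _∷_; replicate)
import Data.Vec.Relation.Unary.All as VecAll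
open import Function
  using (_∘_; case_of_; _⇔_; mk⇔; _↔_; mk↔ₛ′; module Equivalence; module Inverse; module Injection)
open import Function.Properties.Inverse using (↔-refl; ↔-sym; ↔-trans; ↔⇒↣)
open import Level using (Level; 0ℓ)
open import Relation.Binary using (Rel)
open import Relation.Binary.Construct.Closure.ReflexiveTransitive as Star using (Star; ε; _◅_; _◅◅_)
open import Relation.Binary.PropositionalEquality
  using (_≡_; refl; sym; trans; cong; cong₂; subst; subst₂; module ≡-Reasoning)
open import Relation.Nullary using (¬_; contradiction)
open import Relation.Unary using (Pred; _∈_)

-- An address has its most significant bit leftmost, while `val` puts the least significant bit
-- first. The two agree because a counter is read leftwards from a head that rests on the blank
-- after its last bit: a copied address is at once a counter, and a counter is at once an address.
-- It is also why a counter is widened by appending a low bit 0 on the right, which needs no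
-- shifting. Counting an address down destroys it, so the number of input moves to be undone is
-- lost. All addresses from `length w` on read `◁`, so a head position kept as a single address
-- would not tell the end-marker from the blanks beyond it. This is the reason for the second
-- counter. Counters are never shortened, so their width is governed by the highest position in the
-- past and not by the current value; a bound on the head over the entire run is therefore needed.

module Runs (P : Computation) where
  open Computation P

  infix 4 _⇾_ _⇾*_
  _⇾_ _⇾*_ : Config → Config → Set
  _⇾_  = _⟶°_ P
  _⇾*_ = Star _⇾_

  -- Only the part of a run up to its first accepting configuration matters.
  Final : Bool → Config → Set
  Final a f = accepting f ≡ a × (a ≡ false → step f ≡ nothing)

  Ends : Bool → Config → Set
  Ends a f = start ⇾* f × Final a f

  rejecting⇒¬T : ∀ {c} → accepting c ≡ false → ¬ T (accepting c)
  rejecting⇒¬T eq rewrite eq = λ ()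

  final-stuck : ∀ {a f d} → Final a f → ¬ (f ⇾ d)
  final-stuck {true}  (acc , _)   (¬acc , _) = ¬acc (subst T (sym acc) tt)
  final-stuck {false} (_ , halts) (_ , eq)   = case trans (sym eq) (halts refl) of λ ()

  ⇾-deterministic : ∀ {c d e} → c ⇾ d → c ⇾ e → d ≡ e
  ⇾-deterministic (_ , p) (_ , q) = just-injective (trans (sym p) q)

  -- Determinism: a run has no branches, so whatever is reachable lies on the way to the final
  -- configuration. Bounds that hold at the end can thereby be carried back to the whole run.
  confluent : ∀ {a c e f} → Final a f → c ⇾* f → c ⇾* e → e ⇾* f
  confluent φ σ       ε       = σ
  confluent φ ε       (t ◅ τ) = contradiction t (final-stuck φ)
  confluent φ (s ◅ σ) (t ◅ τ) rewrite ⇾-deterministic s t = confluent φ σ τ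

  final-unique : ∀ {a b c e f} → Final a e → Final b f → c ⇾* e → c ⇾* f → e ≡ f
  final-unique φ ψ σ τ with confluent ψ τ σ
  ... | ε     = refl
  ... | s ◅ _ = contradiction s (final-stuck φ)

  -- The run is cut at its first accepting configuration, if it has one. The last component rules
  -- out the verdict `false` for a run that ends accepting.
  reach : ∀ {c e} → Star (_⟶_ P) c e → T (accepting e) ⊎ step e ≡ nothing →
          ∃₂ λ a f → c ⇾* f × Final a f × (T (accepting e) → a ≡ true)
  reach {c} σ end with accepting c in eq
  ... | true = true , c , ε , (eq , λ ()) , λ _ → refl
  reach ε (inj₁ acc)  | false = contradiction acc (rejecting⇒¬T eq)
  reach ε (inj₂ halt) | false =
    false , _ , ε , (eq , λ _ → halt) , λ acc → contradiction acc (rejecting⇒¬T eq)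
  reach (s ◅ σ) end   | false with a , f , τ , φ ← reach σ end =
    a , f , (rejecting⇒¬T eq , s) ◅ τ , φ

  accepts⇒ends : Accepts P → ∃ (Ends true)
  accepts⇒ends (e , σ , acc) with reach σ (inj₁ acc)
  ... | a , f , τ , φ , yes rewrite yes acc = f , τ , φ

  forget : ∀ {c e} → c ⇾* e → Star (_⟶_ P) c e
  forget = Star.map proj₂

  ends⇒accepts : ∀ {f} → Ends true f → Accepts P
  ends⇒accepts (σ , acc , _) = _ , forget σ , subst T (sym acc) tt

  ends⇒rejects : ∀ {f} → Ends false f → Rejects P
  ends⇒rejects (σ , φ@(rej , halts)) = (_ , forget σ , halts refl) , λ acc →
    case accepts⇒ends acc of λ (e , τ , ψ) →
    case trans (sym (proj₁ ψ)) (trans (cong accepting (final-unique ψ φ τ σ)) rej) of λ ()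

  total⇒ends : Accepts P ⊎ Rejects P → ∃₂ Ends
  total⇒ends (inj₁ acc) = true , accepts⇒ends acc
  total⇒ends (inj₂ ((e , σ , halt) , _)) with a , f , τ , φ , _ ← reach σ (inj₂ halt) = a , f , τ , φ

  ends⇒total : ∀ {a f} → Ends a f → Accepts P ⊎ Rejects P
  ends⇒total {true}  E = inj₁ (ends⇒accepts E)
  ends⇒total {false} E = inj₂ (ends⇒rejects E)

  accepts⇒true : ∀ {a f} → Ends a f → Accepts P → a ≡ true
  accepts⇒true {true}  E acc = refl
  accepts⇒true {false} E acc = contradiction acc (proj₂ (ends⇒rejects E))

open Runs using (Ends; confluent; total⇒ends; ends⇒total; accepts⇒true; ends⇒accepts)

-- Step-by-step simulation and the transfer of decisions

record Simulation (P P′ : Computation) : Set₁ where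
  open Computation
  open Runs P using (_⇾_; _⇾*_)
  open Runs P′ using () renaming (_⇾*_ to _⇾′*_)
  field
    R       : Config P → Config P′ → Set
    launch  : ∃[ c′ ] start P′ ⇾′* c′ × R (start P) c′
    -- One step may become many, none of which may leave an accepting configuration. The run leading
    -- to `c` is supplied so that an invariant can refer to positions reached in the past.
    advance : ∀ {c c′ d} → start P ⇾* c → R c c′ → c ⇾ d → ∃[ d′ ] c′ ⇾′* d′ × R d d′
    halt    : ∀ {c c′} → R c c′ → step P c ≡ nothing → step P′ c′ ≡ nothing
    agree   : ∀ {c c′} → R c c′ → accepting P′ c′ ≡ accepting P c

  follow : ∀ {c c′ e} → start P ⇾* c → R c c′ → c ⇾* e → ∃[ e′ ] c′ ⇾′* e′ × R e e′
  follow ρ r ε       = _ , ε , r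
  follow ρ r (s ◅ σ) with advance ρ r s
  ... | d′ , τ , r′ with follow (ρ ◅◅ s ◅ ε) r′ σ
  ...   | e′ , τ′ , r″ = e′ , τ ◅◅ τ′ , r″

  transfer : ∀ {a f} → Ends P a f → ∃[ f′ ] Ends P′ a f′ × R f f′
  transfer (σ , acc , halts) with launch
  ... | c′ , τ , r with follow ε r σ
  ...   | f′ , τ′ , r′ = f′ , (τ ◅◅ τ′ , trans (agree r′) acc , halt r′ ∘ halts) , r′

SpaceBounded : Vocabulary → (List Bool → Computation) → Set
SpaceBounded σ run = ∃[ k ] ∃[ c ] ∃[ N ] (∀ (𝐀 : OrderedStructure σ) → N ≤ n̂ 𝐀 →
  VisitsAtMost (run (bin 𝐀)) (c * ⌈log₂ n̂ 𝐀 ⌉ ^ k))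

module _ {σ : Vocabulary} {ℓ} {𝒞 : Pred (OrderedStructure σ) ℓ} where

  -- Totality gives a final configuration of the first machine, and `transfer` turns it into one of
  -- the second with the same verdict `a`. As verdicts are unique, this settles totality and
  -- correctness; only space remains to be bounded.
  simulated : ∀ {run run′ : List Bool → Computation} →
    (∀ w → Simulation (run w) (run′ w)) → DecidesInPolylogSpace run 𝒞 →
    SpaceBounded σ run′ → DecidesInPolylogSpace run′ 𝒞
  simulated {run} {run′} sim D space′ = record
    { space   = space′
    ; total   = λ 𝐀 → case ends 𝐀 of λ (_ , _ , _ , E′) → ends⇒total (run′ (bin 𝐀)) E′
    ; correct = λ 𝐀 → mk⇔ (sound 𝐀 (ends 𝐀)) (complete 𝐀 (ends 𝐀))
    }
    where
    open DecidesInPolylogSpace D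
    Both : OrderedStructure σ → Set
    Both 𝐀 = ∃[ a ] ∃ (Ends (run (bin 𝐀)) a) × ∃ (Ends (run′ (bin 𝐀)) a)
    ends : ∀ 𝐀 → Both 𝐀
    ends 𝐀 with total⇒ends (run (bin 𝐀)) (total 𝐀)
    ... | a , f , E with Simulation.transfer (sim (bin 𝐀)) E
    ...   | f′ , E′ , _ = a , (f , E) , (f′ , E′)
    sound : ∀ 𝐀 → Both 𝐀 → Accepts (run′ (bin 𝐀)) → 𝐀 ∈ 𝒞
    sound 𝐀 (a , (_ , E) , (_ , E′)) acc with refl ← accepts⇒true (run′ (bin 𝐀)) E′ acc =
      Equivalence.to (correct 𝐀) (ends⇒accepts (run (bin 𝐀)) E)
    complete : ∀ 𝐀 → Both 𝐀 → 𝐀 ∈ 𝒞 → Accepts (run′ (bin 𝐀))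
    complete 𝐀 (a , (_ , E) , (_ , E′)) 𝐀∈𝒞
      with refl ← accepts⇒true (run (bin 𝐀)) E (Equivalence.from (correct 𝐀) 𝐀∈𝒞) =
      ends⇒accepts (run′ (bin 𝐀)) E′

-- Space: the number of stored cells of a tape never decreases and exceeds the
-- head position, so the final configuration bounds the space of the whole run.
size : Tape → ℕ
size (tape l s r) = length l + suc (length r)

position<size : ∀ t → Tape.position t < size t
position<size (tape l s r) = m<m+n (length l) z<s

size-act : ∀ x t → size t ≤ size (act x t)
size-act (s , left)  (tape []      _ r)       = ≤-refl
size-act (s , left)  (tape (x ∷ l) _ r)       = ≤-reflexive (sym (+-suc (length l) (suc (length r))))
size-act (s , right) (tape l       _ [])      = n≤1+n _
size-act (s , right) (tape l       _ (x ∷ r)) = ≤-reflexive (+-suc (length l) (suc (length r)))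
size-act (s , stay)  (tape l       _ r)       = ≤-refl

-- A new cell arises only when the head leaves the stored part to the right; it then scans the last
-- stored cell, so its position bounds the size.
size-act≤ : ∀ {b} x t → size t ≤ b → Tape.position (act x t) < b → size (act x t) ≤ b
size-act≤ (s , left)  (tape []      _ r)       h _ = h
size-act≤ (s , left)  (tape (x ∷ l) _ r)       h _ = ≤-trans (≤-reflexive (+-suc (length l) (suc (length r)))) h
size-act≤ (s , right) (tape l       _ [])      _ p = ≤-trans (≤-reflexive (+-comm (suc (length l)) 1)) p
size-act≤ (s , right) (tape l       _ (x ∷ r)) h _ = ≤-trans (≤-reflexive (sym (+-suc (length l) (suc (length r))))) h
size-act≤ (s , stay)  (tape l       _ r)       h _ = h

Fits : ∀ {k} → ℕ → Vec Tape k → Set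
Fits b = VecAll.All (λ t → size t ≤ b)

module TapeSpace {k : ℕ} (P : Computation) (tapes : Computation.Config P → Vec Tape k)
  (heads≡ : ∀ c → Computation.headPositions P c ≡ Vec.toList (Vec.map Tape.position (tapes c)))
  (acts : ∀ {c d} → Computation.step P c ≡ just d → ∃[ as ] tapes d ≡ actAll as (tapes c)) where

  open Computation P using (start)
  open Runs P using (_⇾*_)

  fits-actAll : ∀ {b j} (as : Vec _ j) ts → Fits b (actAll as ts) → Fits b ts
  fits-actAll []       []       _               = VecAll.[]
  fits-actAll (a ∷ as) (t ∷ ts) (h VecAll.∷ hs) = ≤-trans (size-act a t) h VecAll.∷ fits-actAll as ts hs

  actAll-fits : ∀ {b j} (as : Vec _ j) ts → Fits b ts →
    All (_< b) (Vec.toList (Vec.map Tape.position (actAll as ts))) → Fits b (actAll as ts)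
  actAll-fits []       []       _              _        = VecAll.[]
  actAll-fits (a ∷ as) (t ∷ ts) (h VecAll.∷ hs) (p ∷ ps) = size-act≤ a t h p VecAll.∷ actAll-fits as ts hs ps

  fits⇒heads : ∀ {b j} {ts : Vec _ j} → Fits b ts → All (_< b) (Vec.toList (Vec.map Tape.position ts))
  fits⇒heads VecAll.[]                = []
  fits⇒heads {ts = t ∷ _} (h VecAll.∷ hs) = <-≤-trans (position<size t) h ∷ fits⇒heads hs

  fits-back : ∀ {b c e} → c ⇾* e → Fits b (tapes e) → Fits b (tapes c)
  fits-back ε             h = h
  fits-back ((_ , s) ◅ σ) h with acts s
  ... | as , eq = fits-actAll as _ (subst (Fits _) eq (fits-back σ h))

  ends⇒visits : ∀ {a f b} → Ends P a f → Fits b (tapes f) → VisitsAtMost P b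
  ends⇒visits (σ , φ) h {c} τ =
    subst (All _) (sym (heads≡ c)) (fits⇒heads (fits-back (confluent P φ σ τ) h))

  visits⇒fits : ∀ {b c} → VisitsAtMost P b → Fits b (tapes start) → start ⇾* c → Fits b (tapes c)
  visits⇒fits {b} V h = go ε h
    where
    go : ∀ {c e} → start ⇾* c → Fits b (tapes c) → c ⇾* e → Fits b (tapes e)
    go ρ h ε = h
    go ρ h (_◅_ {j = d} s σ) with acts (proj₂ s)
    ... | as , eq = go (ρ ◅◅ s ◅ ε) (subst (Fits b) (sym eq) (actAll-fits as _ h
          (subst (λ ts → All (_< b) (Vec.toList (Vec.map Tape.position ts))) eq
            (subst (All (_< b)) (heads≡ d) (V (ρ ◅◅ s ◅ ε)))))) σ

module RandomAccessSpace (M : RandomAccessTM) (w : List Bool) where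
  open RandomAccessTM M

  acts : ∀ c {d} → next w c ≡ just d →
         ∃[ as ] Configuration.tapes d ≡ actAll as (Configuration.tapes c)
  acts (config q ts) s with δ q (scannedInput w ts) (scan ts)
  acts (config q ts) refl | just (_ , as) = as , refl

  open TapeSpace (run w) Configuration.tapes (λ _ → refl) (acts _) public

module StandardSpace (M : StandardTM) (w : List Bool) where
  open StandardTM M

  acts : ∀ c {d} → next w c ≡ just d →
         ∃[ as ] Configuration.tapes d ≡ actAll as (Configuration.tapes c)
  acts (config q i ts) s with δ q (inputCell w i) (scan ts)
  acts (config q i ts) refl | just (_ , _ , as) = as , refl

  open TapeSpace (run w) Configuration.tapes (λ _ → refl) (acts _) public

-- Tapes whose heads always move together are the tracks of one tape over a
-- product alphabet.
record Zipper (A : Set) : Set where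
  constructor zipper
  field
    before  : List A
    scanned : A
    after   : List A

mapZ : ∀ {A B : Set} → (A → B) → Zipper A → Zipper B
mapZ f (zipper l c r) = zipper (map f l) (f c) (map f r)

sizeZ : ∀ {A} → Zipper A → ℕ
sizeZ (zipper l c r) = length l + suc (length r)

module _ {A : Set} (blank : A) where

  at : List A → List A → Zipper A
  at l []      = zipper l blank []
  at l (x ∷ r) = zipper l x r

  moveZ : Move → Zipper A → Zipper A
  moveZ left  (zipper []      c r) = zipper [] c r
  moveZ left  (zipper (x ∷ l) c r) = zipper l x (c ∷ r)
  moveZ right (zipper l       c r) = at (c ∷ l) r
  moveZ stay  z                    = z

  actZ : A × Move → Zipper A → Zipper A
  actZ (c , m) (zipper l _ r) = moveZ m (zipper l c r)

track : ∀ {A : Set} → (A → Symbol) → Zipper A → Tape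
track f (zipper l c r) = tape (map f l) (f c) (map f r)

size-track : ∀ {A : Set} (f : A → Symbol) z → size (track f z) ≡ sizeZ z
size-track f (zipper l c r) = cong₂ (λ x y → x + suc y) (length-map f l) (length-map f r)

act-track : ∀ {A : Set} {blank : A} (f : A → Symbol) → f blank ≡ ␣ → ∀ {c} m z →
            act (f c , m) (track f z) ≡ track f (actZ blank (c , m) z)
act-track f b left  (zipper []      _ r)       = refl
act-track f b left  (zipper (x ∷ l) _ r)       = refl
act-track f b {c} right (zipper l   _ [])      = cong (λ s → tape (f c ∷ map f l) s []) (sym b)
act-track f b right (zipper l       _ (x ∷ r)) = refl
act-track f b stay  (zipper l       _ r)       = refl

idle : ∀ {k} → Vec Symbol k → Vec (Symbol × Move) k
idle = Vec.map (_, stay)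

act-idle : ∀ {k} (ts : Vec Tape k) → actAll (idle (scan ts)) ts ≡ ts
act-idle []       = refl
act-idle (t ∷ ts) = cong (t ∷_) (act-idle ts)

-- Binary counters, least significant bit first

val : ∀ {n} → Vec Bool n → ℕ
val []       = 0
val (b ∷ bs) = (if b then 1 else 0) + 2 * val bs

dec : ∀ {n} → Vec Bool n → Maybe (Vec Bool n)
dec []           = nothing
dec (true  ∷ bs) = just (false ∷ bs)
dec (false ∷ bs) = Maybe.map (true ∷_) (dec bs)

dec-nothing : ∀ {n} (bs : Vec Bool n) → dec bs ≡ nothing → val bs ≡ 0
dec-nothing []           eq = refl
dec-nothing (false ∷ bs) eq with dec bs in p
... | nothing rewrite dec-nothing bs p = refl

dec-just : ∀ {n} (bs : Vec Bool n) {bs′} → dec bs ≡ just bs′ → val bs ≡ suc (val bs′)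
dec-just (true  ∷ bs) refl = refl
dec-just (false ∷ bs) eq   with dec bs in p
dec-just (false ∷ bs) refl | just bs′ rewrite dec-just bs p = cong suc (+-suc (val bs′) (val bs′ + 0))

val≤val-ones : ∀ {n} (bs : Vec Bool n) → val bs ≤ val (replicate n true)
val≤val-ones []           = z≤n
val≤val-ones (true  ∷ bs) = s≤s (*-monoʳ-≤ 2 (val≤val-ones bs))
val≤val-ones (false ∷ bs) = m≤n⇒m≤1+n (*-monoʳ-≤ 2 (val≤val-ones bs))

val-zeros : ∀ n → val (replicate n false) ≡ 0
val-zeros zero    = refl
val-zeros (suc n) rewrite val-zeros n = refl

-- The flag reports an overflow, after which a new lowest bit 0 is still to be added.
inc : ∀ {n} → Vec Bool (suc n) → Bool × Vec Bool (suc n)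
inc (false ∷ bs)     = false , true ∷ bs
inc (true  ∷ [])     = true , true ∷ []
inc (true  ∷ b ∷ bs) = map₂ (false ∷_) (inc (b ∷ bs))

inc-val : ∀ {n} (bs : Vec Bool (suc n)) {bs′} → inc bs ≡ (false , bs′) → val bs′ ≡ suc (val bs)
inc-val (false ∷ bs)     refl = refl
inc-val (true  ∷ b ∷ bs) eq   with inc (b ∷ bs) in p
inc-val (true  ∷ b ∷ bs) refl | false , bs′ rewrite inc-val (b ∷ bs) p =
  cong suc (+-suc (val (b ∷ bs)) (val (b ∷ bs) + 0))

-- Overflow occurs only at 1...1, which becomes 0...01 of value 2^n; the low bit 0 still to be added
-- doubles it. The lower bound later charges the additional bit to the value that required it.
inc-overflow : ∀ {n} (bs : Vec Bool (suc n)) {bs′} → inc bs ≡ (true , bs′) →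
               2 * val bs′ ≡ suc (val bs) × 2 ^ n ≤ val bs′
inc-overflow (true ∷ [])     refl = refl , s≤s z≤n
inc-overflow (true ∷ b ∷ bs) eq   with inc (b ∷ bs) in p
inc-overflow (true ∷ b ∷ bs) refl | true , bs′ with q , h ← inc-overflow (b ∷ bs) p =
  trans (cong (2 *_) q) (cong suc (+-suc (val (b ∷ bs)) (val (b ∷ bs) + 0))) , *-monoʳ-≤ 2 h

-- A counter occupies the cells to the left of its head, one bit in the first
-- component of each cell; the second component marks the leftmost cell by 𝟙.

Op : Set
Op = Fin 5

pattern borrow = zero
pattern fill   = suc zero
pattern ret    = suc (suc zero)
pattern carry  = suc (suc (suc zero))
pattern grow   = suc (suc (suc (suc zero)))

-- `φ` is the bit with which an exhausted counter is refilled: 1 where the counter must then time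
-- the return of the input head, 0 where it must stay zero. `X` holds tracks that are carried along
-- unchanged. The operations `ret`, `fill` and `grow` all take the head back to the blank; they
-- differ in reporting no wrap-around, an underflow or an overflow.
module Counter (X : Set) (x₀ : X) (φ : Bool) where

  Load Cell : Set
  Load = Symbol × X
  Cell = Symbol × Load

  load₀ : Load
  load₀ = ␣ , x₀

  blank : Cell
  blank = ␣ , load₀

  micro : Op → Cell → Maybe (Op × Cell × Move)
  -- A blank on the leftmost cell is a counter without bits: the empty address, whose value is 0.
  micro borrow (␣ , 𝟙 , x) = just (fill   , (␣ , 𝟙 , x)     , stay)
  micro borrow (␣ , v)     = just (borrow , (␣ , v)         , left)
  micro borrow (𝟙 , v)     = just (ret    , (𝟘 , v)         , right)
  micro borrow (𝟘 , 𝟙 , x) = just (fill   , (bit φ , 𝟙 , x) , right)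
  micro borrow (𝟘 , v)     = just (borrow , (𝟙 , v)         , left)
  micro carry  (␣ , v)     = just (carry  , (␣ , v)         , left)
  micro carry  (𝟘 , v)     = just (ret    , (𝟙 , v)         , right)
  micro carry  (𝟙 , 𝟙 , x) = just (grow   , (𝟙 , 𝟙 , x)     , right)
  micro carry  (𝟙 , v)     = just (carry  , (𝟘 , v)         , left)
  micro _      (␣ , _)     = nothing
  micro fill   (_ , v)     = just (fill , (bit φ , v) , right)
  micro o      (d , v)     = just (o    , (d , v)     , right)

  data _↝_ : Op × Zipper Cell → Op × Zipper Cell → Set where
    tick : ∀ {o o′ l c c′ r m z} → micro o c ≡ just (o′ , c′ , m) →
           moveZ blank m (zipper l c′ r) ≡ z → (o , zipper l c r) ↝ (o′ , z)

  data Marked : List Load → Set where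
    leftmost : ∀ {x} → Marked ((𝟙 , x) ∷ [])
    _∷_ : ∀ x {v vs} → Marked (v ∷ vs) → Marked ((␣ , x) ∷ v ∷ vs)

  cells : (vs : List Load) → Vec Bool (length vs) → List Cell
  cells []       []       = []
  cells (v ∷ vs) (b ∷ bs) = (bit b , v) ∷ cells vs bs

  decremented : ∀ {n} → Maybe (Vec Bool n) → Op × Vec Bool n
  decremented (just bs) = ret , bs
  decremented nothing   = fill , replicate _ φ

  step-ret : ∀ {l r} b {v} → (ret , zipper l (bit b , v) r) ↝ (ret , at blank ((bit b , v) ∷ l) r)
  step-ret true  = tick refl refl
  step-ret false = tick refl refl

  step-fill : ∀ {l r} b {v} → (fill , zipper l (bit b , v) r) ↝ (fill , at blank ((bit φ , v) ∷ l) r)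
  step-fill true  = tick refl refl
  step-fill false = tick refl refl

  step-grow : ∀ {l r} b {v} → (grow , zipper l (bit b , v) r) ↝ (grow , at blank ((bit b , v) ∷ l) r)
  step-grow true  = tick refl refl
  step-grow false = tick refl refl

  borrow-run : ∀ {v vs} → Marked (v ∷ vs) → ∀ b bs r →
    let (o , bs′) = decremented (dec (b ∷ bs)) in
    Star _↝_ (borrow , zipper (cells vs bs) (bit b , v) r) (o , at blank (cells (v ∷ vs) bs′) r)
  borrow-run leftmost   true  []       r = tick refl refl ◅ ε
  borrow-run (x ∷ M) true  (b ∷ bs) r = tick refl refl ◅ ε
  borrow-run leftmost   false []       r = tick refl refl ◅ ε
  -- The bit 0 is flipped to 1 in advance; on the way back `ret` keeps the 1 and `fill` overwrites
  -- it.
  borrow-run (x ∷ M) false (b ∷ bs) r with dec (b ∷ bs) | borrow-run M b bs ((𝟙 , ␣ , x) ∷ r)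
  ... | just (_ ∷ _) | σ = tick refl refl ◅ σ ◅◅ step-ret true ◅ ε
  ... | nothing      | σ = tick refl refl ◅ σ ◅◅ step-fill true ◅ ε

  decrement-run : ∀ {v vs} → Marked (v ∷ vs) → ∀ bs r →
    let (o , bs′) = decremented (dec bs) in
    Star _↝_ (borrow , zipper (cells vs bs) (␣ , v) r) (o , zipper (cells vs bs′) (␣ , v) r)
  decrement-run leftmost   []       r = tick refl refl ◅ ε
  decrement-run (x ∷ M) (b ∷ bs) r = tick refl refl ◅ borrow-run M b bs (_ ∷ r)

  incremented : ∀ {n} → Bool × Vec Bool n → Op × Vec Bool n
  incremented (overflow , bs) = (if overflow then grow else ret) , bs

  carry-run : ∀ {v vs} → Marked (v ∷ vs) → ∀ b bs r →
    let (o , bs′) = incremented (inc (b ∷ bs)) in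
    Star _↝_ (carry , zipper (cells vs bs) (bit b , v) r) (o , at blank (cells (v ∷ vs) bs′) r)
  carry-run leftmost   false []       r = tick refl refl ◅ ε
  carry-run (x ∷ M) false (b ∷ bs) r = tick refl refl ◅ ε
  carry-run leftmost   true  []       r = tick refl refl ◅ ε
  carry-run (x ∷ M) true  (b ∷ bs) r with inc (b ∷ bs) | carry-run M b bs ((𝟘 , ␣ , x) ∷ r)
  ... | false , _ ∷ _ | σ = tick refl refl ◅ σ ◅◅ step-ret false ◅ ε
  ... | true  , _ ∷ _ | σ = tick refl refl ◅ σ ◅◅ step-grow false ◅ ε

  increment-run : ∀ {x v vs} → Marked (v ∷ vs) → ∀ bs r →
    let (o , bs′) = incremented (inc bs) in
    Star _↝_ (carry , zipper (cells (v ∷ vs) bs) (␣ , ␣ , x) r) (o , zipper (cells (v ∷ vs) bs′) (␣ , ␣ , x) r)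
  increment-run M (b ∷ bs) r = tick refl refl ◅ carry-run M b bs (_ ∷ r)

-- Moving the input head to an address

forward : InputSymbol → Move
forward ◁     = stay
forward ⌞ _ ⌟ = right

walk : List Bool → ℕ → ℕ → ℕ
walk w zero    i = i
walk w (suc n) i = walk w n (moveInput (forward (inputCell w i)) i)

walk-[] : ∀ n → walk [] n 0 ≡ 0
walk-[] zero    = refl
walk-[] (suc n) = walk-[] n

walk-∷ : ∀ b w n i → walk (b ∷ w) n (suc i) ≡ suc (walk w n i)
walk-∷ b w zero    i = refl
walk-∷ b w (suc n) i with inputCell w i
... | ◁     = walk-∷ b w n i
... | ⌞ _ ⌟ = walk-∷ b w n (suc i)

-- The head waits on `◁`, so an address beyond the input still reads the end-marker, as random
-- access demands, and not the blanks to the right of it.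
walk-reads : ∀ w n → inputCell w (walk w n 0) ≡ randomAccess w n
walk-reads []      n rewrite walk-[] n      = refl
walk-reads (b ∷ w) zero                     = refl
walk-reads (b ∷ w) (suc n) rewrite walk-∷ b w n 0 = walk-reads w n

walk≤ : ∀ w n i → walk w n i ≤ n + i
walk≤ w zero    i = ≤-refl
walk≤ w (suc n) i with inputCell w i
... | ◁     = m≤n⇒m≤1+n (walk≤ w n i)
... | ⌞ _ ⌟ = ≤-trans (walk≤ w n (suc i)) (≤-reflexive (+-suc n i))

-- A tape that stores one more trailing blank.
pad : Bool → Tape → Tape
pad false t            = t
pad true  (tape l s r) = tape l s (r ++ [ ␣ ])

-- Copying an address ends on its first blank. If none is stored, that blank comes into being when
-- the head leaves the stored cells, and the tape becomes one cell longer than the simulated one.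
deficit : List Symbol → Bool
deficit []      = true
deficit (𝟘 ∷ s) = deficit s
deficit (𝟙 ∷ s) = deficit s
deficit (␣ ∷ s) = false

deficit-∷ : ∀ a {s} → deficit s ≡ false → deficit (a ∷ s) ≡ false
deficit-∷ 𝟘 eq = eq
deficit-∷ 𝟙 eq = eq
deficit-∷ ␣ eq = refl

deficit-pad : ∀ t → deficit (Tape.contents (pad true t)) ≡ false
deficit-pad (tape l s r) = before l (deficit-∷ s (after r))
  where
  after : ∀ r → deficit (r ++ [ ␣ ]) ≡ false
  after []      = refl
  after (a ∷ r) = deficit-∷ a (after r)
  before : ∀ l {s} → deficit s ≡ false → deficit (l ʳ++ s) ≡ false
  before []      eq = eq
  before (a ∷ l) eq = before l (deficit-∷ a eq)

-- The padding itself supplies a blank, so repeated lookups never add a second cell; this keeps the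
-- overhead in space at one.
pad-pad : ∀ m t → ∃[ m′ ] pad (deficit (Tape.contents (pad m t))) (pad m t) ≡ pad m′ t
pad-pad false t = _ , refl
pad-pad true  t rewrite deficit-pad t = true , refl

readBinary-pad : ∀ m t → readBinary (Tape.contents (pad m t)) ≡ readBinary (Tape.contents t)
readBinary-pad false t            = refl
readBinary-pad true  (tape l s r) = before l (cons s (after r)) 0
  where
  _≈_ : List Symbol → List Symbol → Set
  x ≈ y = ∀ n → readFrom n x ≡ readFrom n y
  cons : ∀ a {x y} → x ≈ y → (a ∷ x) ≈ (a ∷ y)
  cons 𝟘 eq n = eq (2 * n)
  cons 𝟙 eq n = eq (2 * n + 1)
  cons ␣ eq n = refl
  after : ∀ r → (r ++ [ ␣ ]) ≈ r
  after []      n = refl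
  after (a ∷ r)   = cons a (after r)
  before : ∀ l {x y} → x ≈ y → (l ʳ++ x) ≈ (l ʳ++ y)
  before []      eq = eq
  before (a ∷ l) eq = before l (cons a eq)

size-pad : ∀ m t → size (pad m t) ≤ suc (size t)
size-pad false t            = n≤1+n _
size-pad true  (tape l s r) = ≤-reflexive (trans
  (cong (λ n → length l + suc n) (trans (length-++ r) (+-comm (length r) 1)))
  (+-suc (length l) (suc (length r))))

-- The padding is used up exactly when `t` itself gains a cell on the right.
act-pad : ∀ x m t → ∃[ m′ ] act x (pad m t) ≡ pad m′ (act x t)
act-pad x           false t                        = false , refl
act-pad (s , left)  true  (tape []      _ r)       = true , refl
act-pad (s , left)  true  (tape (x ∷ l) _ r)       = true , refl
act-pad (s , right) true  (tape l       _ [])      = false , refl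
act-pad (s , right) true  (tape l       _ (x ∷ r)) = true , refl
act-pad (s , stay)  true  (tape l       _ r)       = true , refl

deficit-bit : ∀ b s → deficit (bit b ∷ s) ≡ deficit s
deficit-bit false s = refl
deficit-bit true  s = refl

-- Each symbol read becomes the new least significant bit, just as each cell copied becomes the
-- nearest one to the left of the head. Hence copying builds a counter without any rearrangement.
readFrom-bit : ∀ b {n} (bs : Vec Bool n) s → readFrom (val bs) (bit b ∷ s) ≡ readFrom (val (b ∷ bs)) s
readFrom-bit false bs s = refl
readFrom-bit true  bs s = cong (λ n → readFrom n s) (+-comm (2 * val bs) 1)

-- Lookup of an address by a sequential machine

Phase : Set
Phase = Fin 8

pattern initialise = zero
pattern mark       = suc zero
pattern home       = suc (suc zero)
pattern copy       = suc (suc (suc zero))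
pattern find       = suc (suc (suc (suc zero)))
pattern back       = suc (suc (suc (suc (suc zero))))
pattern rewind     = suc (suc (suc (suc (suc (suc zero)))))
pattern seek       = suc (suc (suc (suc (suc (suc (suc zero))))))

markAt : List Symbol → Symbol
markAt []      = 𝟙
markAt (_ ∷ _) = ␣

plain : Symbol → Symbol × Symbol × Symbol
plain a = ␣ , a , ␣

loads : List Symbol → List (Symbol × Symbol × Symbol)
loads []      = []
loads (a ∷ l) = (markAt l , a , ␣) ∷ loads l

-- The last three tracks between two simulated steps, when t is the address-tape.
load : Tape → Zipper (Symbol × Symbol × Symbol)
load (tape l s r) = zipper (loads l) (markAt l , s , ␣) (map plain r)

act-load : ∀ s m t → actZ (␣ , ␣ , ␣) ((proj₁ (Zipper.scanned (load t)) , s , ␣) , m) (load t) ≡ load (act (s , m) t)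
act-load s left  (tape []      _ r)       = refl
act-load s left  (tape (x ∷ l) _ r)       = refl
act-load s right (tape l       _ [])      = refl
act-load s right (tape l       _ (x ∷ r)) = refl
act-load s stay  (tape l       _ r)       = refl

-- The four tracks hold a scratch counter, the mark of the leftmost cell, the
-- simulated address-tape and the mark of its head position.  The counter is a
-- copy of the address; `find` counts it down to −1 while moving the input head
-- to the right, `back` does the same from the resulting 1…1 while moving the
-- input head back to the leftmost cell.
module Control where

  open Counter (Symbol × Symbol) (␣ , ␣) true public

  Stage : Set
  Stage = Phase × Op × InputSymbol

  -- `inj₂ x` ends the lookup and hands over the symbol `x`, which travels in the state because the
  -- input head has to leave it behind.
  Action : Set
  Action = (Stage ⊎ InputSymbol) × Move × Cell × Move

  counting : Phase → InputSymbol → Action → Maybe (Op × Cell × Move) → Action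
  counting p x exit nothing             = exit
  counting p x exit (just (o , c , m)) = inj₁ (p , o , x) , stay , c , m

  -- Underflow means that the address has been counted down completely, so the symbol `y` now
  -- scanned is the wanted one and replaces the placeholder `x`.
  found : Op → (x y : InputSymbol) → Cell → Action
  found fill x y c = inj₁ (back , borrow , y) , stay , c , stay
  found _    x y c = inj₁ (find , borrow , x) , forward y , c , stay

  returned : Op → InputSymbol → Cell → Action
  returned fill x c = inj₁ (rewind , borrow , x) , stay , c , stay
  returned _    x c = inj₁ (back , borrow , x) , left , c , stay

  control : Stage → InputSymbol → Cell → Action
  control (initialise , o , x) y (d , _ , _ , h) = inj₁ (mark , o , x) , stay , (d , 𝟙 , 𝟘 , h) , stay
  control (mark   , o , x) y (d , m , a , _)     = inj₁ (home , o , x) , stay , (d , m , a , 𝟙) , stay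
  control (home   , o , x) y (d , 𝟙 , v)         = inj₁ (copy , o , x) , stay , (d , 𝟙 , v) , stay
  control (home   , o , x) y c                   = inj₁ (home , o , x) , stay , c , left
  control (copy   , o , x) y (_ , m , ␣ , h)     = inj₁ (find , borrow , x) , stay , (␣ , m , ␣ , h) , stay
  control (copy   , o , x) y (_ , m , a , h)     = inj₁ (copy , o , x) , stay , (a , m , a , h) , right
  control (find   , o , x) y c                   = counting find x (found o x y c) (micro o c)
  control (back   , o , x) y c                   = counting back x (returned o x c) (micro o c)
  control (rewind , o , x) y (d , 𝟙 , v)         = inj₁ (seek , o , x) , stay , (d , 𝟙 , v) , stay
  control (rewind , o , x) y c                   = inj₁ (rewind , o , x) , stay , c , left
  control (seek   , o , x) y (d , m , a , 𝟙)     = inj₂ x , stay , (d , m , a , ␣) , stay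
  control (seek   , o , x) y c                   = inj₁ (seek , o , x) , stay , c , right

module Lookup (w : List Bool) where

  open Control

  data _↦_ : Rel ((Stage ⊎ InputSymbol) × ℕ × Zipper Cell) 0ℓ where
    step : ∀ {s s′ i i′ l c c′ r mᵢ m z} → control s (inputCell w i) c ≡ (s′ , mᵢ , c′ , m) →
           moveInput mᵢ i ≡ i′ → moveZ blank m (zipper l c′ r) ≡ z →
           (inj₁ s , i , zipper l c r) ↦ (s′ , i′ , z)

  infix 4 _↦_ _↦*_
  _↦*_ : Rel ((Stage ⊎ InputSymbol) × ℕ × Zipper Cell) 0ℓ
  _↦*_ = Star _↦_

  retarget : ∀ {c d e} → d ≡ e → c ↦* d → c ↦* e
  retarget refl σ = σ

  finding : ∀ {x i o o′ z z′} → Star _↝_ (o , z) (o′ , z′) →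
            (inj₁ (find , o , x) , i , z) ↦* (inj₁ (find , o′ , x) , i , z′)
  finding {x} {i} = Star.gmap (λ (o , z) → inj₁ (find , o , x) , i , z)
    λ { (tick eq eq′) → step (cong (counting find x _) eq) refl eq′ }

  backing : ∀ {x i o o′ z z′} → Star _↝_ (o , z) (o′ , z′) →
            (inj₁ (back , o , x) , i , z) ↦* (inj₁ (back , o′ , x) , i , z′)
  backing {x} {i} = Star.gmap (λ (o , z) → inj₁ (back , o , x) , i , z)
    λ { (tick eq eq′) → step (cong (counting back x _) eq) refl eq′ }

  Unmarked : Cell → Set
  Unmarked (_ , m , _) = m ≡ ␣

  address : Cell → Symbol
  address (_ , _ , a , _) = a

  -- The stage is left open because `home` and `rewind` both run left to the mark in this way.
  home-run : ∀ {s s′} →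
    (∀ y d v → control s y (d , 𝟙 , v) ≡ (inj₁ s′ , stay , (d , 𝟙 , v) , stay)) →
    (∀ y d v → control s y (d , ␣ , v) ≡ (inj₁ s , stay , (d , ␣ , v) , left)) →
    ∀ i l c r → Marked (map proj₂ (c ∷ l)) → All Unmarked r →
    ∃₂ λ c₀ r₀ → (inj₁ s , i , zipper l c r) ↦* (inj₁ s′ , i , zipper [] c₀ r₀) ×
      c₀ ∷ r₀ ≡ l ʳ++ c ∷ r × Marked (proj₂ c₀ ∷ []) × All Unmarked r₀
  home-run stop go i []      c r leftmost us = c , r , step (stop _ _ _) refl refl ◅ ε , refl , leftmost , us
  home-run stop go i (x ∷ l) c r (v ∷ M) us
    with c₀ , r₀ , σ , eq , M′ , us′ ← home-run stop go i l x (c ∷ r) M (refl ∷ us) =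
    c₀ , r₀ , step (go _ _ v) refl refl ◅ σ , eq , M′ , us′

  padding : Bool → List Load
  padding false = []
  padding true  = [ load₀ ]

  copy-step : ∀ {o x i l d m h r} b →
    (inj₁ (copy , o , x) , i , zipper l (d , m , bit b , h) r) ↦
    (inj₁ (copy , o , x) , i , at blank ((bit b , m , bit b , h) ∷ l) r)
  copy-step false = step refl refl refl
  copy-step true  = step refl refl refl

  record Copied (o : Op) (x : InputSymbol) (i : ℕ) (vs : List Load) (bs : Vec Bool (length vs))
                (c : Cell) (r : List Cell) : Set where
    field
      {load′}  : Load
      {loads′} : List Load
      {bits′}  : Vec Bool (length loads′)
      {after′} : List Cell
      steps    : (inj₁ (copy , o , x) , i , zipper (cells vs bs) c r) ↦*
                 (inj₁ (find , borrow , x) , i , zipper (cells loads′ bits′) (␣ , load′) after′)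
      marked   : Marked (load′ ∷ loads′)
      unmarked : All Unmarked after′
      same     : loads′ ʳ++ load′ ∷ map proj₂ after′ ≡
                 vs ʳ++ map proj₂ (c ∷ r) ++ padding (deficit (map address (c ∷ r)))
      value    : val bits′ ≡ readFrom (val bs) (map address (c ∷ r))

  copy-run : ∀ o x i vs bs c r → Marked (proj₂ c ∷ vs) → All Unmarked r → Copied o x i vs bs c r
  copy-bit : ∀ o x i vs bs d m b h r → Marked ((m , bit b , h) ∷ vs) → All Unmarked r →
             Copied o x i vs bs (d , m , bit b , h) r

  copy-run o x i vs bs (d , m , 𝟘 , h) r M us = copy-bit o x i vs bs d m false h r M us
  copy-run o x i vs bs (d , m , 𝟙 , h) r M us = copy-bit o x i vs bs d m true h r M us
  copy-run o x i vs bs (d , m , ␣ , h) r M us = record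
    { steps    = step refl refl refl ◅ ε
    ; marked   = M
    ; unmarked = us
    ; same     = cong (λ r′ → vs ʳ++ (m , ␣ , h) ∷ r′) (sym (++-identityʳ (map proj₂ r)))
    ; value    = refl
    }

  copy-bit o x i vs bs d m b h [] M us = record
    { steps    = copy-step b ◅ step refl refl refl ◅ ε
    ; marked   = _ ∷ M
    ; unmarked = []
    ; same     = cong (λ p → vs ʳ++ (m , bit b , h) ∷ padding p) (sym (deficit-bit b []))
    ; value    = sym (readFrom-bit b bs [])
    }
  copy-bit o x i vs bs d m b h (c ∷ r) M (refl ∷ us) =
    let open Copied (copy-run o x i _ (b ∷ bs) c r (_ ∷ M) us) in record
    { steps    = copy-step b ◅ steps
    ; marked   = marked
    ; unmarked = unmarked
    ; same     = trans same (cong (λ p → vs ʳ++ (m , bit b , h) ∷ map proj₂ (c ∷ r) ++ padding p)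
                                  (sym (deficit-bit b (map address (c ∷ r)))))
    ; value    = trans value (sym (readFrom-bit b bs (map address (c ∷ r))))
    }

  find-run : ∀ n {v vs} → Marked (v ∷ vs) → ∀ bs → val bs ≡ n → ∀ x i r →
    (inj₁ (find , borrow , x) , i , zipper (cells vs bs) (␣ , v) r) ↦*
    (inj₁ (back , borrow , inputCell w (walk w n i)) , walk w n i , zipper (cells vs (replicate _ true)) (␣ , v) r)
  find-run n M bs eq x i r with dec bs in p | decrement-run M bs r
  find-run zero    M bs eq x i r | nothing  | σ = finding σ ◅◅ step refl refl refl ◅ ε
  find-run zero    M bs eq x i r | just bs′ | σ = contradiction (trans (sym eq) (dec-just bs p)) λ ()
  find-run (suc n) M bs eq x i r | nothing  | σ = contradiction (trans (sym eq) (dec-nothing bs p)) λ ()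
  find-run (suc n) M bs eq x i r | just bs′ | σ =
    finding σ ◅◅ step refl refl refl ◅
    find-run n M bs′ (suc-injective (trans (sym (dec-just bs p)) eq)) x _ r

  pred-∸ : ∀ i n → pred i ∸ n ≡ i ∸ suc n
  pred-∸ zero    n = 0∸n≡0 n
  pred-∸ (suc i) n = refl

  -- Left moves on the leftmost cell have no effect, which is the truncation in `i ∸ n`: the counter
  -- may safely hold more than the distance to be covered.
  back-run : ∀ n {v vs} → Marked (v ∷ vs) → ∀ bs → val bs ≡ n → ∀ x i r →
    (inj₁ (back , borrow , x) , i , zipper (cells vs bs) (␣ , v) r) ↦*
    (inj₁ (rewind , borrow , x) , i ∸ n , zipper (cells vs (replicate _ true)) (␣ , v) r)
  back-run n M bs eq x i r with dec bs in p | decrement-run M bs r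
  back-run zero    M bs eq x i r | nothing  | σ = backing σ ◅◅ step refl refl refl ◅ ε
  back-run zero    M bs eq x i r | just bs′ | σ = contradiction (trans (sym eq) (dec-just bs p)) λ ()
  back-run (suc n) M bs eq x i r | nothing  | σ = contradiction (trans (sym eq) (dec-nothing bs p)) λ ()
  back-run (suc n) M bs eq x i r | just bs′ | σ rewrite sym (pred-∸ i n) =
    backing σ ◅◅ step refl refl refl ◅
    back-run n M bs′ (suc-injective (trans (sym (dec-just bs p)) eq)) x _ r

  Unvisited : Load → Set
  Unvisited (_ , _ , h) = h ≡ ␣

  seek-run : ∀ {o x i m a ws} us l K → map proj₂ K ≡ us ++ (m , a , 𝟙) ∷ ws → All Unvisited us →
    ∃[ l′ ] ∃₂ λ d r′ →
    (inj₁ (seek , o , x) , i , at blank l K) ↦* (inj₂ x , i , zipper l′ (d , m , a , ␣) r′) ×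
    map proj₂ l′ ≡ us ʳ++ map proj₂ l × map proj₂ r′ ≡ ws
  seek-run [] l (c ∷ K) eq [] with refl , refl ← ∷-injective eq =
    l , _ , K , step refl refl refl ◅ ε , refl , refl
  seek-run (u ∷ us) l (c ∷ K) eq (refl ∷ hs) with refl , eq′ ← ∷-injective eq
    with l′ , d , r′ , σ , p , q ← seek-run us (c ∷ l) K eq′ hs =
    l′ , d , r′ , step refl refl refl ◅ σ , p , q


  marked-loads : ∀ s l {h} → Marked ((markAt l , s , h) ∷ loads l)
  marked-loads s []      = leftmost
  marked-loads s (a ∷ l) = _ ∷ marked-loads a l

  unmarked-plain : ∀ r s → map proj₂ r ≡ map plain s → All Unmarked r
  unmarked-plain []      s       eq = []
  unmarked-plain (c ∷ r) (a ∷ s) eq with refl , eq′ ← ∷-injective eq = refl ∷ unmarked-plain r s eq′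

  loads-address : ∀ l → map (proj₁ ∘ proj₂) (loads l) ≡ l
  loads-address []      = refl
  loads-address (a ∷ l) = cong (a ∷_) (loads-address l)

  plain-address : ∀ r → map (proj₁ ∘ proj₂) (map plain r) ≡ r
  plain-address []      = refl
  plain-address (a ∷ r) = cong (a ∷_) (plain-address r)

  unvisited-reverse : ∀ l {us} → All Unvisited us → All Unvisited (loads l ʳ++ us)
  unvisited-reverse []      hs = hs
  unvisited-reverse (a ∷ l) hs = unvisited-reverse l (refl ∷ hs)

  plain-padding : ∀ p t → zipper (loads (Tape.before t)) (markAt (Tape.before t) , Tape.scanned t , ␣)
    (map plain (Tape.after t) ++ padding p) ≡ load (pad p t)
  plain-padding false t            = cong (zipper _ _) (++-identityʳ _)
  plain-padding true  (tape l s r) = cong (zipper _ _) (sym (map-++ plain r [ ␣ ]))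

  record Fetched (o : Op) (x : InputSymbol) (t : Tape) (z : Zipper Cell) : Set where
    open Tape t
    field
      {load′}  : Load
      {loads′} : List Load
      {bits′}  : Vec Bool (length loads′)
      {after′} : List Cell
      steps    : (inj₁ (mark , o , x) , 0 , z) ↦*
                 (inj₁ (find , borrow , x) , 0 , zipper (cells loads′ bits′) (␣ , load′) after′)
      marked   : Marked (load′ ∷ loads′)
      unmarked : All Unmarked after′
      same     : loads′ ʳ++ load′ ∷ map proj₂ after′ ≡
                 reverse (loads before) ++ (markAt before , scanned , 𝟙) ∷ map plain after ++ padding (deficit contents)
      value    : val bits′ ≡ readBinary contents

  -- The hypothesis leaves the counter track arbitrary: digits from earlier lookups are overwritten,
  -- or lie to the right of the blank on which the counter ends.
  fetch-run : ∀ o x t z → mapZ proj₂ z ≡ load t → Fetched o x t z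
  fetch-run o x t@(tape tl s tr) (zipper l (d , v) r) eq with refl ← cong Zipper.scanned eq =
    let c₀ , r₀ , homing , eq₀ , M₀ , us₀ = home-run {home , o , x} (λ _ _ _ → refl) (λ _ _ _ → refl)
          0 l (d , u) r
          (subst (λ vs → Marked (u ∷ vs)) (sym before) (marked-loads s tl)) (unmarked-plain r tr after)
        loads≡ = begin
          map proj₂ (c₀ ∷ r₀)                                         ≡⟨ cong (map proj₂) eq₀ ⟩
          map proj₂ (l ʳ++ (d , u) ∷ r)                               ≡⟨ map-ʳ++ proj₂ l ⟩
          map proj₂ l ʳ++ u ∷ map proj₂ r                             ≡⟨ cong₂ (λ l r → l ʳ++ u ∷ r) before after ⟩
          loads tl ʳ++ u ∷ map plain tr                               ∎
        address≡ = begin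
          map address (c₀ ∷ r₀)                                       ≡⟨ map-∘ (c₀ ∷ r₀) ⟩
          map tape₃ (map proj₂ (c₀ ∷ r₀))                             ≡⟨ cong (map tape₃) loads≡ ⟩
          map tape₃ (loads tl ʳ++ u ∷ map plain tr)                   ≡⟨ map-ʳ++ tape₃ (loads tl) ⟩
          map tape₃ (loads tl) ʳ++ s ∷ map tape₃ (map plain tr)
            ≡⟨ cong₂ (λ l r → l ʳ++ s ∷ r) (loads-address tl) (plain-address tr) ⟩
          tl ʳ++ s ∷ tr                                               ∎
        open Copied (copy-run o x 0 [] [] c₀ r₀ M₀ us₀)
    in record
    { steps    = step refl refl refl ◅ homing ◅◅ steps
    ; marked   = marked
    ; unmarked = unmarked
    ; same     = trans same (begin
        map proj₂ (c₀ ∷ r₀) ++ padding (deficit (map address (c₀ ∷ r₀)))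
          ≡⟨ cong₂ (λ vs as → vs ++ padding (deficit as)) loads≡ address≡ ⟩
        (loads tl ʳ++ u ∷ map plain tr) ++ pads                           ≡⟨ cong (_++ pads) (ʳ++-defn (loads tl)) ⟩
        (reverse (loads tl) ++ u ∷ map plain tr) ++ pads                  ≡⟨ ++-assoc (reverse (loads tl)) _ _ ⟩
        reverse (loads tl) ++ u ∷ map plain tr ++ pads                    ∎)
    ; value    = trans value (cong readBinary address≡)
    }
    where
    open ≡-Reasoning
    u      = markAt tl , s , 𝟙
    before = cong Zipper.before eq
    after  = cong Zipper.after eq
    tape₃  = λ (v : Load) → proj₁ (proj₂ v)
    pads   = padding (deficit (Tape.contents t))

  load-cells : ∀ vs bs → map proj₂ (cells vs bs) ≡ vs
  load-cells []       []       = refl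
  load-cells (v ∷ vs) (b ∷ bs) = cong (v ∷_) (load-cells vs bs)

  lookup-run : ∀ o x t z → mapZ proj₂ z ≡ load t → ∃[ z′ ]
    (inj₁ (mark , o , x) , 0 , z) ↦* (inj₂ (randomAccess w (readBinary (Tape.contents t))) , 0 , z′) ×
    mapZ proj₂ z′ ≡ load (pad (deficit (Tape.contents t)) t)
  lookup-run o x t@(tape tl s tr) z eq =
    let open Fetched (fetch-run o x t z eq)
        n    = readBinary (Tape.contents t)
        ones = replicate (length loads′) true
        -- The head went at most `n` cells to the right, and `n`, held in equally many bits, is at
        -- most the value of 1...1.
        home≡0 : walk w n 0 ∸ val ones ≡ 0
        home≡0 = m≤n⇒m∸n≡0 (≤-trans (subst (walk w n 0 ≤_) (+-identityʳ n) (walk≤ w n 0))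
                                      (subst (_≤ val ones) value (val≤val-ones bits′)))
        homing = retarget
          (cong₂ (λ y i → inj₁ (rewind , borrow , y) , i , zipper (cells loads′ ones) (␣ , load′) after′)
                 (walk-reads w n) home≡0)
          (back-run (val ones) marked ones refl (inputCell w (walk w n 0)) (walk w n 0) after′)
        c₁ , r₁ , rewinding , eq₁ , _ = home-run {rewind , borrow , randomAccess w n}
          (λ _ _ _ → refl) (λ _ _ _ → refl) 0 (cells loads′ ones) (␣ , load′) after′
          (subst (λ vs → Marked (load′ ∷ vs)) (sym (load-cells loads′ ones)) marked) unmarked
        l′ , d′ , r′ , seeking , p , q = seek-run {borrow} {randomAccess w n} {0} (reverse (loads tl)) [] (c₁ ∷ r₁)
          (trans (cong (map proj₂) eq₁) (trans (map-ʳ++ proj₂ (cells loads′ ones))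
            (trans (cong (_ʳ++ load′ ∷ map proj₂ after′) (load-cells loads′ ones)) same)))
          (unvisited-reverse tl [])
    in zipper l′ (d′ , markAt tl , s , ␣) r′ ,
       steps ◅◅ find-run n marked bits′ value x 0 after′ ◅◅ homing ◅◅ rewinding ◅◅ seeking ,
       trans (cong₂ (λ l r → zipper l (markAt tl , s , ␣) r) (trans p (reverse-involutive (loads tl))) q)
             (plain-padding (deficit (Tape.contents t)) t)

-- Finiteness of state sets, and sizes of tracks

Finite : Set → Set
Finite A = ∃[ m ] (A ↔ Fin m)

Fin-finite : ∀ n → Finite (Fin n)
Fin-finite n = n , ↔-refl

_×-finite_ : ∀ {A B} → Finite A → Finite B → Finite (A × B)
(m , f) ×-finite (n , g) = m * n , ↔-trans (f ×-↔ g) (↔-sym *↔×)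

_⊎-finite_ : ∀ {A B} → Finite A → Finite B → Finite (A ⊎ B)
(m , f) ⊎-finite (n , g) = m + n , ↔-trans (f ⊎-↔ g) (↔-sym +↔⊎)

InputSymbol-finite : Finite InputSymbol
InputSymbol-finite = 4 , mk↔ₛ′ to from to-from from-to
  where
  to : InputSymbol → Fin 4
  to ◁     = zero
  to ⌞ 𝟘 ⌟ = suc zero
  to ⌞ 𝟙 ⌟ = suc (suc zero)
  to ⌞ ␣ ⌟ = suc (suc (suc zero))
  from : Fin 4 → InputSymbol
  from zero                   = ◁
  from (suc zero)             = ⌞ 𝟘 ⌟
  from (suc (suc zero))       = ⌞ 𝟙 ⌟
  from (suc (suc (suc zero))) = ⌞ ␣ ⌟
  to-from : ∀ i → to (from i) ≡ i
  to-from zero                   = refl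
  to-from (suc zero)             = refl
  to-from (suc (suc zero))       = refl
  to-from (suc (suc (suc zero))) = refl
  from-to : ∀ x → from (to x) ≡ x
  from-to ◁     = refl
  from-to ⌞ 𝟘 ⌟ = refl
  from-to ⌞ 𝟙 ⌟ = refl
  from-to ⌞ ␣ ⌟ = refl

scanned-pad : ∀ p t → Tape.scanned (pad p t) ≡ Tape.scanned t
scanned-pad false t = refl
scanned-pad true  t = refl

mapZ-act : ∀ {A B : Set} {b₀ : A} (f : A → B) {c} m z →
           mapZ f (actZ b₀ (c , m) z) ≡ actZ (f b₀) (f c , m) (mapZ f z)
mapZ-act f left  (zipper []      _ r)       = refl
mapZ-act f left  (zipper (x ∷ l) _ r)       = refl
mapZ-act f right (zipper l       _ [])      = refl
mapZ-act f right (zipper l       _ (x ∷ r)) = refl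
mapZ-act f stay  (zipper l       _ r)       = refl

sizeZ-map : ∀ {A B : Set} (f : A → B) z → sizeZ (mapZ f z) ≡ sizeZ z
sizeZ-map f (zipper l c r) = cong₂ (λ x y → x + suc y) (length-map f l) (length-map f r)

sizeZ-load : ∀ t → sizeZ (load t) ≡ size t
sizeZ-load (tape l s r) = cong₂ (λ x y → x + suc y) (length-loads l) (length-map plain r)
  where
  length-loads : ∀ l → length (loads l) ≡ length l
  length-loads []      = refl
  length-loads (a ∷ l) = cong suc (length-loads l)

fits-blank : ∀ {b} k → 1 ≤ b → Fits b (replicate k blankTape)
fits-blank zero    h = VecAll.[]
fits-blank (suc k) h = h VecAll.∷ fits-blank k h


-- A sequential machine for a random-access machine

module Sequential (M : RandomAccessTM) where

  private module M = RandomAccessTM M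
  open M using (F; k)
  open Control

  Q : Set
  Q = M.Q × (Stage ⊎ InputSymbol)

  respond : M.Q → Vec Symbol k → Action → Q × Move × Vec (Symbol × Move) (4 + k)
  respond q ss (s , mᵢ , (d , m , a , h) , mv) =
    (q , s) , mᵢ , (d , mv) ∷ (m , mv) ∷ (a , mv) ∷ (h , mv) ∷ idle ss

  imitate : Symbol → Symbol → Symbol → M.Q × Vec (Symbol × Move) (suc k) → Q × Move × Vec (Symbol × Move) (4 + k)
  imitate d m h (q , (a , mv) ∷ as) =
    (q , inj₁ (mark , borrow , ◁)) , stay , (d , mv) ∷ (m , mv) ∷ (a , mv) ∷ (h , mv) ∷ as

  δ : Q → InputSymbol → Vec Symbol (4 + k) → Maybe (Q × Move × Vec (Symbol × Move) (4 + k))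
  δ (q , inj₁ s) y (d ∷ m ∷ a ∷ h ∷ ss) = just (respond q ss (control s y (d , m , a , h)))
  δ (q , inj₂ x) y (d ∷ m ∷ a ∷ h ∷ ss) = Maybe.map (imitate d m h) (M.δ q x (a ∷ ss))

  accept : Q → Bool
  accept (q , inj₁ _) = false
  accept (q , inj₂ _) = F q

  machine : StandardTM
  machine = record
    { Q      = Q
    ; finite = M.finite ×-finite ((Fin-finite 8 ×-finite (Fin-finite 5 ×-finite InputSymbol-finite)) ⊎-finite
               InputSymbol-finite)
    ; q₀     = M.q₀ , inj₁ (initialise , borrow , ◁)
    ; F      = accept
    ; k      = 4 + k
    ; k≥1    = s≤s z≤n
    ; δ      = δ
    }

  open StandardTM machine using (Configuration; config; next)

  module On (w : List Bool) where

    open Lookup w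
    open Runs (M.run w) using (_⇾_; _⇾*_)
    open Runs (StandardTM.run machine w) using () renaming (_⇾_ to _⇾′_; _⇾*_ to _⇾′*_)

    tracks : Zipper Cell → Vec Tape k → Vec Tape (4 + k)
    tracks z ts = track proj₁ z ∷ track (proj₁ ∘ proj₂) z ∷ track (proj₁ ∘ proj₂ ∘ proj₂) z ∷
                  track (proj₂ ∘ proj₂ ∘ proj₂) z ∷ ts

    embed : M.Q → Vec Tape k → (Stage ⊎ InputSymbol) × ℕ × Zipper Cell → Configuration
    embed q ts (s , i , z) = config (q , s) i (tracks z ts)

    act-tracks : ∀ d m a h mv z as ts →
      actAll ((d , mv) ∷ (m , mv) ∷ (a , mv) ∷ (h , mv) ∷ as) (tracks z ts) ≡
      tracks (actZ blank ((d , m , a , h) , mv) z) (actAll as ts)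
    act-tracks d m a h mv z as ts =
      cong₂ _∷_ (act-track proj₁ refl mv z) (cong₂ _∷_ (act-track _ refl mv z)
        (cong₂ _∷_ (act-track _ refl mv z) (cong₂ _∷_ (act-track (proj₂ ∘ proj₂ ∘ proj₂) refl mv z) refl)))

    lift : ∀ q ts {c d} → c ↦ d → embed q ts c ⇾′ embed q ts d
    lift q ts (step {s} {i = i} {l = l} {c} {r = r} {mᵢ} {m} eq refl refl) = (λ ()) , trans
      (cong (λ α → just (StandardTM.perform machine i (tracks (zipper l c r) ts) (respond q (scan ts) α))) eq)
      (cong (just ∘ config _ _) (trans (act-tracks _ _ _ _ m (zipper l c r) (idle (scan ts)) ts)
        (cong (tracks (moveZ blank m (zipper l _ r))) (act-idle ts))))

    lift* : ∀ q ts {c d} → c ↦* d → embed q ts c ⇾′* embed q ts d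
    lift* q ts = Star.gmap (embed q ts) (lift q ts)

    -- The symbol at the current address has already been looked up. Because the lookup follows a
    -- step and does not precede the next one, the simulating machine is stuck as soon as the
    -- simulated one is.
    data Related : M.Configuration → Configuration → Set where
      related : ∀ {q t ts z} p → mapZ proj₂ z ≡ load (pad p t) →
        Related (M.config q (t ∷ ts)) (embed q ts (inj₂ (M.scannedInput w (t ∷ ts)) , 0 , z))

    look : ∀ {o x} q ts p t z → mapZ proj₂ z ≡ load (pad p t) →
      ∃[ c′ ] embed q ts (inj₁ (mark , o , x) , 0 , z) ⇾′* c′ × Related (M.config q (t ∷ ts)) c′
    look {o} {x} q ts p t z eq with z′ , σ , eq′ ← lookup-run o x (pad p t) z eq | p′ , eq″ ← pad-pad p t =
      _ , lift* q ts (retarget (cong (λ n → inj₂ (randomAccess w n) , 0 , z′) (readBinary-pad p t)) σ) ,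
      related p′ (trans eq′ (cong load eq″))

    launch : ∃[ c′ ] config (M.q₀ , inj₁ (initialise , borrow , ◁)) 0 (replicate (4 + k) blankTape) ⇾′* c′ ×
      Related M.initial c′
    launch with c′ , σ , r ← look {borrow} {◁} M.q₀ (replicate k blankTape) false (tape [] 𝟘 []) _ refl =
      c′ , lift M.q₀ (replicate k blankTape)
        (step {s = initialise , borrow , ◁} {l = []} {c = blank} {r = []} refl refl refl) ◅ σ , r

    scanned-address : ∀ p t (z : Zipper Cell) → mapZ proj₂ z ≡ load (pad p t) →
      proj₁ (proj₂ (proj₂ (Zipper.scanned z))) ≡ Tape.scanned t
    scanned-address p t z eq = trans (cong (λ z → proj₁ (proj₂ (Zipper.scanned z))) eq) (scanned-pad p t)

    act-address : ∀ p t z a mv → mapZ proj₂ z ≡ load (pad p t) →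
      let (d , m , _ , h) = Zipper.scanned z in
      ∃[ p′ ] mapZ proj₂ (actZ blank ((d , m , a , h) , mv) z) ≡ load (pad p′ (act (a , mv) t))
    act-address p t z@(zipper l (d , m , _ , h) r) a mv eq with p′ , eq′ ← act-pad (a , mv) p t = p′ , (begin
      mapZ proj₂ (actZ blank ((d , m , a , h) , mv) z)  ≡⟨ mapZ-act proj₂ mv z ⟩
      actZ load₀ ((m , a , h) , mv) (mapZ proj₂ z)      ≡⟨ cong act′ eq ⟩
      act′ (load (pad p t))                             ≡⟨ act-load a mv (pad p t) ⟩
      load (act (a , mv) (pad p t))                     ≡⟨ cong load eq′ ⟩
      load (pad p′ (act (a , mv) t))                    ∎)
      where
      open ≡-Reasoning
      act′ : Zipper Load → Zipper Load
      act′ z′ = actZ load₀ ((proj₁ (Zipper.scanned z′) , a , proj₂ (proj₂ (Zipper.scanned z′))) , mv) z′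

    imitates : ∀ {q q′ x i a mv as} ts z →
      M.δ q x (proj₁ (proj₂ (proj₂ (Zipper.scanned z))) ∷ scan ts) ≡ just (q′ , (a , mv) ∷ as) →
      let (d , m , _ , h) = Zipper.scanned z in
      next w (embed q ts (inj₂ x , i , z)) ≡
      just (embed q′ (actAll as ts) (inj₁ (mark , borrow , ◁) , i , actZ blank ((d , m , a , h) , mv) z))
    imitates {i = i} {mv = mv} {as} ts z eq = trans
      (cong (λ r → Maybe.map (StandardTM.perform machine i (tracks z ts)) (Maybe.map (imitate _ _ _) r)) eq)
      (cong (just ∘ config _ _) (act-tracks _ _ _ _ mv z as ts))

    advance : ∀ {c c′ d} → Related c c′ → c ⇾ d → ∃[ d′ ] c′ ⇾′* d′ × Related d d′
    advance (related {q} {t} {ts} {z} p eq) (¬acc , s) with M.δ q (M.scannedInput w (t ∷ ts)) (scan (t ∷ ts)) in δ≡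
    advance (related {q} {t} {ts} {z} p eq) (¬acc , refl) | just (q′ , (a , mv) ∷ as)
      with p′ , eq′ ← act-address p t z a mv eq
      with c′ , σ , r ← look {borrow} {◁} q′ (actAll as ts) p′ (act (a , mv) t) _ eq′ =
      c′ , (¬acc , imitates ts z
        (trans (cong (λ a → M.δ q (M.scannedInput w (t ∷ ts)) (a ∷ scan ts)) (scanned-address p t z eq)) δ≡)) ◅ σ , r

    halt : ∀ {c c′} → Related c c′ → M.next w c ≡ nothing → next w c′ ≡ nothing
    halt (related {q} {t} {ts} {z} p eq) s with M.δ q (M.scannedInput w (t ∷ ts)) (scan (t ∷ ts)) in δ≡
    ... | nothing = cong (λ r → Maybe.map (StandardTM.perform machine 0 (tracks z ts)) (Maybe.map (imitate _ _ _) r))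
      (trans (cong (λ a → M.δ q (M.scannedInput w (t ∷ ts)) (a ∷ scan ts)) (scanned-address p t z eq)) δ≡)

    simulation : Simulation (M.run w) (StandardTM.run machine w)
    simulation = record
      { R       = Related
      ; launch  = launch
      ; advance = λ _ → advance
      ; halt    = halt
      ; agree   = λ { (related _ _) → refl }
      }

    fits-related : ∀ {b c c′} → Related c c′ → Fits b (M.Configuration.tapes c) → Fits (suc b) (Configuration.tapes c′)
    fits-related {b} (related {t = t} {z = z} p eq) (h VecAll.∷ hs) =
      fits proj₁ VecAll.∷ fits _ VecAll.∷ fits _ VecAll.∷ fits _ VecAll.∷ VecAll.map m≤n⇒m≤1+n hs
      where
      fits : ∀ f → size (track f z) ≤ suc b
      fits f = begin
        size (track f z)        ≡⟨ size-track f z ⟩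
        sizeZ z                 ≡⟨ sizeZ-map proj₂ z ⟨
        sizeZ (mapZ proj₂ z)    ≡⟨ cong sizeZ eq ⟩
        sizeZ (load (pad p t))  ≡⟨ sizeZ-load (pad p t) ⟩
        size (pad p t)          ≤⟨ size-pad p t ⟩
        suc (size t)            ≤⟨ s≤s h ⟩
        suc b                   ∎
        where open ≤-Reasoning

    module Source = RandomAccessSpace M w
    module Target = StandardSpace machine w

    visits : ∀ {b a f} → Ends (M.run w) a f → VisitsAtMost (M.run w) b →
      VisitsAtMost (StandardTM.run machine w) (suc b)
    visits E V with f′ , E′ , r ← Simulation.transfer simulation E =
      Target.ends⇒visits E′ (fits-related r (Source.visits⇒fits V start-fits (proj₁ E)))
      where
      start-fits : Fits _ (M.Configuration.tapes M.initial)
      start-fits = 0<b VecAll.∷ fits-blank k 0<b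
        where 0<b = All.head (V ε)

VisitsAtMost-mono : ∀ {P b b′} → b ≤ b′ → VisitsAtMost P b → VisitsAtMost P b′
VisitsAtMost-mono h V σ = All.map (λ p → <-≤-trans p h) (V σ)

1≤⌈log₂⌉ : ∀ {n} → 2 ≤ n → 1 ≤ ⌈log₂ n ⌉
1≤⌈log₂⌉ h = ≤-trans (≤-reflexive (sym (⌈log₂2^n⌉≡n 1))) (⌈log₂⌉-mono-≤ h)

module _ {σ : Vocabulary} {ℓ} {𝒞 : Pred (OrderedStructure σ) ℓ} where

  randomAccess⇒standard : RandomAccessDecidable 𝒞 → StandardDecidable 𝒞
  randomAccess⇒standard (M , D) = machine , simulated (On.simulation) D (space′ space)
    where
    open Sequential M
    open DecidesInPolylogSpace D
    space′ : SpaceBounded σ (RandomAccessTM.run M) → SpaceBounded σ (StandardTM.run machine)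
    -- From encoding length 2 on the logarithm is at least 1, so one more multiple of its power
    -- absorbs the extra cell.
    space′ (κ , c , N , V) = κ , suc c , N + 2 , λ 𝐀 h → VisitsAtMost-mono
      (+-monoˡ-≤ (c * ⌈log₂ n̂ 𝐀 ⌉ ^ κ) (m^n>0 ⌈log₂ n̂ 𝐀 ⌉ {{>-nonZero (1≤⌈log₂⌉ (≤-trans (m≤n+m 2 N) h))}} κ))
      (On.visits (bin 𝐀) (proj₂ (proj₂ (total⇒ends (RandomAccessTM.run M (bin 𝐀)) (total 𝐀))))
        (V 𝐀 (≤-trans (m≤m+n N 2) h)))


-- Counting tape contents

digit : List Symbol → Fin 4
digit []      = zero
digit (𝟘 ∷ _) = suc zero
digit (𝟙 ∷ _) = suc (suc zero)
digit (␣ ∷ _) = suc (suc (suc zero))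

-- The end of the list counts as a fourth digit, so that lists of different lengths up to `b`
-- receive different codes.
code : ∀ b → List Symbol → Fin (4 ^ b)
code zero    xs = zero
code (suc b) xs = combine {4} {4 ^ b} (digit xs) (code b (drop 1 xs))

code-injective : ∀ b {xs ys} → length xs ≤ b → length ys ≤ b → code b xs ≡ code b ys → xs ≡ ys
code-injective zero    {[]} {[]} _ _ _ = refl
code-injective (suc b) {xs} {ys} h h′ eq =
  uncons xs ys h h′ (combine-injective {4} {4 ^ b} (digit xs) (code b (drop 1 xs)) (digit ys) (code b (drop 1 ys)) eq)
  where
  uncons : ∀ xs ys → length xs ≤ suc b → length ys ≤ suc b →
    digit xs ≡ digit ys × code b (drop 1 xs) ≡ code b (drop 1 ys) → xs ≡ ys
  uncons []       []       _       _        _       = refl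
  uncons []       (𝟘 ∷ ys) _       _        (() , _)
  uncons []       (𝟙 ∷ ys) _       _        (() , _)
  uncons []       (␣ ∷ ys) _       _        (() , _)
  uncons (𝟘 ∷ xs) []       _       _        (() , _)
  uncons (𝟙 ∷ xs) []       _       _        (() , _)
  uncons (␣ ∷ xs) []       _       _        (() , _)
  uncons (𝟘 ∷ xs) (𝟘 ∷ ys) (s≤s h) (s≤s h′) (_ , q) = cong (𝟘 ∷_) (code-injective b h h′ q)
  uncons (𝟙 ∷ xs) (𝟙 ∷ ys) (s≤s h) (s≤s h′) (_ , q) = cong (𝟙 ∷_) (code-injective b h h′ q)
  uncons (␣ ∷ xs) (␣ ∷ ys) (s≤s h) (s≤s h′) (_ , q) = cong (␣ ∷_) (code-injective b h h′ q)

tapeCount : ℕ → ℕ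
tapeCount b = 4 ^ b * 4 ^ b

codeTape : ∀ b → Tape → Fin (tapeCount b)
codeTape b (tape l s r) = combine (code b l) (code b (s ∷ r))

codeTape-injective : ∀ b {t u} → size t ≤ b → size u ≤ b → codeTape b t ≡ codeTape b u → t ≡ u
codeTape-injective b {tape l s r} {tape l′ s′ r′} h h′ eq
  with p , q ← combine-injective (code b l) (code b (s ∷ r)) (code b l′) (code b (s′ ∷ r′)) eq
  with refl ← code-injective b (m+n≤o⇒m≤o (length l) h) (m+n≤o⇒m≤o (length l′) h′) p
     | refl ← code-injective b {s ∷ r} {s′ ∷ r′} (m+n≤o⇒n≤o (length l) h) (m+n≤o⇒n≤o (length l′) h′) q = refl

codeTapes : ∀ b {k} → Vec Tape k → Fin (tapeCount b ^ k)
codeTapes b []       = zero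
codeTapes b (t ∷ ts) = combine (codeTape b t) (codeTapes b ts)

codeTapes-injective : ∀ b {k} {ts us : Vec Tape k} → Fits b ts → Fits b us → codeTapes b ts ≡ codeTapes b us → ts ≡ us
codeTapes-injective b {ts = []}     {[]}     _                 _                 eq = refl
codeTapes-injective b {ts = t ∷ ts} {u ∷ us} (h VecAll.∷ hs) (h′ VecAll.∷ hs′) eq
  with p , q ← combine-injective (codeTape b t) (codeTapes b ts) (codeTape b u) (codeTapes b us) eq =
  cong₂ _∷_ (codeTape-injective b h h′ p) (codeTapes-injective b hs hs′ q)

inputCell-beyond : ∀ w i → length w < i → inputCell w i ≡ ⌞ ␣ ⌟
inputCell-beyond []      (suc i) h       = refl
inputCell-beyond (b ∷ w) (suc i) (s≤s h) = inputCell-beyond w i h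

moveInput-+ : ∀ m i δ → 0 < i → moveInput m (i + δ) ≡ moveInput m i + δ
moveInput-+ left  (suc i) δ _ = refl
moveInput-+ right i       δ _ = refl
moveInput-+ stay  i       δ _ = refl

-- Beyond the end-marker the input head is a counter that cannot be tested for
-- zero.  If the same state and tapes recur at two heights of a climb, then the
-- machine climbs forever.
module InputHead (M : StandardTM) (w : List Bool) where

  open StandardTM M
  open Configuration
  open Runs (run w) using (_⇾_; _⇾*_; Final; ⇾-deterministic; final-stuck)

  step-moves : ∀ {c d} → c ⇾ d → ∃[ m ] inputHead d ≡ moveInput m (inputHead c)
  step-moves {config q i ts} (_ , s) with δ q (inputCell w i) (scan ts)
  step-moves {config q i ts} (_ , refl) | just (_ , m , _) = m , refl

  Climb : ℕ → Rel Configuration 0ℓ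
  Climb p = Star (λ c d → p ≤ inputHead c × c ⇾ d)

  weaken : ∀ {p p′ c d} → p ≤ p′ → Climb p′ c d → Climb p c d
  weaken h = Star.map λ (h′ , s) → ≤-trans h h′ , s

  descend : ∀ {p c d} → Climb p c d → c ⇾* d
  descend = Star.map proj₂

  -- As maintained by `extend`, the rungs are the last visits to the heights 0, ..., h. From a rung
  -- on, the head never drops below it, so the run between two rungs is a climb.
  data Ladder : ℕ → Configuration → Set where
    base : ∀ {c} → initial ⇾* c → inputHead c ≡ 0 → Ladder 0 c
    rung : ∀ {h c d} → Ladder h c → Climb h c d → inputHead d ≡ suc h → Ladder (suc h) d

  top : ∀ {h c} → Ladder h c → inputHead c ≡ h
  top (base _ eq)   = eq
  top (rung _ _ eq) = eq

  replace : ∀ {h c d} → Ladder h c → Climb h c d → inputHead d ≡ h → Ladder h d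
  replace (base ρ _)   κ eq = base (ρ ◅◅ descend κ) eq
  replace (rung L κ _) κ′ eq = rung L (κ ◅◅ weaken (n≤1+n _) κ′) eq

  extend : ∀ {h c d} → Ladder h c → c ⇾ d → Ladder (inputHead d) d
  extend {d = d} L s with step-moves s
  ... | stay , eq with e ← top L rewrite trans eq e =
    replace L ((≤-reflexive (sym e) , s) ◅ ε) (trans eq e)
  ... | right , eq with e ← top L rewrite trans eq (cong suc e) =
    rung L ((≤-reflexive (sym e) , s) ◅ ε) (trans eq (cong suc e))
  extend L@(base _ e) s | left , eq rewrite trans eq (cong pred e) =
    replace L ((z≤n , s) ◅ ε) (trans eq (cong pred e))
  extend (rung L κ e) s | left , eq rewrite trans eq (cong pred e) =
    replace L (κ ◅◅ (≤-trans (n≤1+n _) (≤-reflexive (sym e)) , s) ◅ ε) (trans eq (cong pred e))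

  ladder : ∀ {c} → initial ⇾* c → Ladder (inputHead c) c
  ladder = go (base ε refl)
    where
    go : ∀ {h c d} → Ladder h c → c ⇾* d → Ladder (inputHead d) d
    go L ε       = subst (λ h → Ladder h _) (sym (top L)) L
    go L (s ◅ σ) = go (extend L s) σ

  -- Indexed from the top of the ladder.
  level : ∀ {h c} → Ladder h c → Fin (suc h) → Configuration
  level {c = c} L          zero    = c
  level         (rung L _ _) (suc i) = level L i

  level-head : ∀ {h c} (L : Ladder h c) i → inputHead (level L i) + toℕ i ≡ h
  level-head L            zero    = trans (+-identityʳ _) (top L)
  level-head (rung L _ _) (suc i) = trans (+-suc _ (toℕ i)) (cong suc (level-head L i))

  level-climb : ∀ {h c} (L : Ladder h c) i j → i Fin.≤ j → Climb (inputHead (level L j)) (level L j) (level L i)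
  level-climb L            zero    zero    _       = ε
  level-climb (rung L κ _) zero    (suc j) _       =
    level-climb L zero j z≤n ◅◅ weaken (m+n≤o⇒m≤o _ (≤-reflexive (level-head L j))) κ
  level-climb (rung L _ _) (suc i) (suc j) (s≤s h) = level-climb L i j h

  level-reachable : ∀ {h c} (L : Ladder h c) i → initial ⇾* level L i
  level-reachable (base ρ _)   zero    = ρ
  level-reachable (rung L κ _) zero    = level-reachable L zero ◅◅ descend κ
  level-reachable (rung L κ _) (suc i) = level-reachable L i

  shift : ℕ → Configuration → Configuration
  shift δ (config q i ts) = config q (i + δ) ts

  -- Every cell beyond position `length w` is blank, so the transition cannot depend on how far out
  -- the head is.
  shift-step : ∀ δ {c d} → length w < inputHead c → c ⇾ d → shift δ c ⇾ shift δ d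
  shift-step j {config q i ts} h (¬acc , s) rewrite inputCell-beyond w i h with δ q ⌞ ␣ ⌟ (scan ts) in eq
  shift-step j {config q i ts} h (¬acc , refl) | just (q′ , m , as) = ¬acc ,
    trans (cong (λ y → Maybe.map (perform (i + j) ts) (δ q y (scan ts)))
      (inputCell-beyond w (i + j) (≤-trans h (m≤m+n i j))))
    (trans (cong (Maybe.map (perform (i + j) ts)) eq)
      (cong (λ i → just (config q′ i _)) (moveInput-+ m i j (≤-trans (s≤s z≤n) h))))

  shift-climb : ∀ δ {p c d} → length w < p → Climb p c d → shift δ c ⇾* shift δ d
  shift-climb δ h = Star.gmap (shift δ) λ (h′ , s) → shift-step δ (<-≤-trans h h′) s

  pump : ∀ {q p δ ts} → length w < p → initial ⇾* config q p ts →
         Climb p (config q p ts) (config q (p + δ) ts) → ∀ s → initial ⇾* config q (p + s * δ) ts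
  pump {q} {p} {δ} {ts} h ρ κ zero    = subst (λ i → initial ⇾* config q i ts) (sym (+-identityʳ p)) ρ
  pump {q} {p} {δ} {ts} h ρ κ (suc s) = pump h ρ κ s ◅◅
    subst (λ i → config q (p + s * δ) ts ⇾* config q i ts) (+-assoc p δ (s * δ)) (shift-climb (s * δ) h κ)

  bounded : ∀ {a c f} → c ⇾* f → Final a f → ∃[ B ] (∀ {e} → c ⇾* e → inputHead e ≤ B)
  bounded ε φ = _ , λ { ε → ≤-refl ; (s ◅ _) → contradiction s (final-stuck φ) }
  bounded {c = c} (s ◅ σ) φ with B , h ← bounded σ φ = inputHead c ⊔ B , λ where
    ε       → m≤m⊔n _ B
    (t ◅ τ) → ≤-trans (h (subst (_⇾* _) (⇾-deterministic t s) τ)) (m≤n⊔m (inputHead c) B)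

  no-pump : ∀ {a f q p δ ts} → Ends (run w) a f → length w < p → initial ⇾* config q p ts →
            Climb p (config q p ts) (config q (p + suc δ) ts) → ⊥
  no-pump {p = p} {δ} (σ , φ) h ρ κ with B , bound ← bounded σ φ = <-irrefl refl (begin-strict
    B                    <⟨ n<1+n B ⟩
    suc B                ≤⟨ m≤m*n (suc B) (suc δ) ⟩
    suc B * suc δ        ≤⟨ m≤n+m _ p ⟩
    p + suc B * suc δ    ≤⟨ bound (pump h ρ κ (suc B)) ⟩
    B                    ∎)
    where open ≤-Reasoning

  recur-absurd : ∀ {a f c c′} → Ends (run w) a f → initial ⇾* c → length w < inputHead c →
    inputHead c < inputHead c′ →
    state c′ ≡ state c → tapes c′ ≡ tapes c → Climb (inputHead c) c c′ → ⊥
  recur-absurd {c = config q p ts} {config _ p′ _} E ρ h p<p′ refl refl κ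
    with δ , refl ← m≤n⇒∃[o]m+o≡n p<p′ =
    no-pump E h ρ (subst (λ i → Climb p (config q p ts) (config q i ts)) (sym (+-suc p δ)) κ)

  configurations : ℕ → ℕ
  configurations b = proj₁ finite * tapeCount b ^ k

  -- If the head were higher, the top `N + 1` rungs would all lie beyond the end-marker and two of
  -- them would agree in state and tapes. The climb between these could be repeated forever, which a
  -- run that ends excludes.
  inputHead≤ : ∀ {a b f c} → Ends (run w) a f → (∀ {c} → initial ⇾* c → Fits b (tapes c)) →
               initial ⇾* c → inputHead c ≤ length w + configurations b
  inputHead≤ {b = b} {c = c} E fits ρ = ≮⇒≥ λ high →
    let L = ladder ρ
        N = configurations b
        N<h : suc N ≤ suc (inputHead c)
        N<h = s≤s (≤-trans (m≤n+m N (length w)) (<⇒≤ high))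
        at : Fin (suc N) → Configuration
        at i = level L (inject≤ i N<h)
        codeAt : Fin (suc N) → Fin N
        codeAt i = combine (Inverse.to (proj₂ finite) (state (at i))) (codeTapes b (tapes (at i)))
        i , j , i<j , eq = pigeonhole (n<1+n N) codeAt
        p , q = combine-injective (Inverse.to (proj₂ finite) (state (at i))) (codeTapes b (tapes (at i))) _ _ eq
        L≡ : ∀ i → inputHead (at i) + toℕ i ≡ inputHead c
        L≡ i = trans (cong (inputHead (at i) +_) (sym (toℕ-inject≤ i N<h))) (level-head L (inject≤ i N<h))
    -- Rungs are numbered from the top, so the larger index `j` is where the repeated climb begins.
    in recur-absurd E (level-reachable L (inject≤ j N<h))
         (≰⇒> λ low → <⇒≱ high (≤-trans (≤-reflexive (sym (L≡ j))) (+-mono-≤ low (toℕ≤pred[n] j))))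
         (≰⇒> λ low → <⇒≢ (+-mono-≤-< low i<j) (trans (L≡ i) (sym (L≡ j))))
         (Injection.injective (↔⇒↣ (proj₂ finite)) p)
         (codeTapes-injective b (fits (level-reachable L (inject≤ i N<h))) (fits (level-reachable L (inject≤ j N<h))) q)
         (level-climb L (inject≤ i N<h) (inject≤ j N<h)
           (subst₂ _≤_ (sym (toℕ-inject≤ i N<h)) (sym (toℕ-inject≤ j N<h)) (<⇒≤ i<j)))


-- A random-access machine for a sequential machine

inputCell≡randomAccess : ∀ w i → i ≤ length w → inputCell w i ≡ randomAccess w i
inputCell≡randomAccess []      zero    h       = refl
inputCell≡randomAccess (b ∷ w) zero    h       = refl
inputCell≡randomAccess (b ∷ w) (suc i) (s≤s h) = inputCell≡randomAccess w i h

randomAccess-end : ∀ w → randomAccess w (length w) ≡ ◁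
randomAccess-end []      = refl
randomAccess-end (b ∷ w) = randomAccess-end w

randomAccess-bit : ∀ w i → i < length w → ∃[ b ] randomAccess w i ≡ ⌞ bit b ⌟
randomAccess-bit (b ∷ w) zero    h       = b , refl
randomAccess-bit (b ∷ w) (suc i) (s≤s h) = randomAccess-bit w i h

pattern setup   = inj₁ zero
pattern rest    = inj₁ (suc zero)
pattern count o = inj₂ o

-- The input head position i is kept as a ≤ |w| on the address-tape, and, once
-- the head has moved beyond the end-marker, as i = |w| + 1 + d with d in a
-- second counter.  The flag tells the two regions apart.
module Addressed (M : StandardTM) where

  private module M = StandardTM M
  open M using (F; k)
  open Counter ⊤ tt false

  State : Set
  State = Bool × (Fin 2 ⊎ Op)

  Q : Set
  Q = M.Q × State

  seen : Bool → InputSymbol → InputSymbol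
  seen false y = y
  seen true  y = ⌞ ␣ ⌟

  schedule : Bool → Move → InputSymbol → State
  schedule beyond left  y = beyond , count borrow
  schedule false  right ◁ = true , rest
  schedule beyond right y = beyond , count carry
  schedule beyond stay  y = beyond , rest

  -- Underflow has two causes: a left move on the leftmost input cell, and the step from the first
  -- cell beyond the end-marker back onto it. In both, the zeros filled in and the flag `false` are
  -- right, so one rule serves. After an overflow the missing low bit 0 is written on the blank
  -- under the head.
  finish : Bool → Op → Cell → State × Cell × Move
  finish beyond fill c       = (false , rest) , c , stay
  finish beyond grow (_ , v) = (beyond , rest) , (𝟘 , v) , right
  finish beyond _    c       = (beyond , rest) , c , stay

  counting : Bool → State × Cell × Move → Maybe (Op × Cell × Move) → State × Cell × Move
  counting beyond exit nothing            = exit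
  counting beyond exit (just (o , c , m)) = (beyond , count o) , c , m

  operate : Bool → Op → Cell → State × Cell × Move
  operate beyond o c = counting beyond (finish beyond o c) (micro o c)

  respond : M.Q → Bool → (c c′ : Cell) → Vec Symbol k → State × Cell × Move → Q × Vec (Symbol × Move) (4 + k)
  respond q false _ (d′ , m′ , _) ss (s , (d , m , _) , mv) =
    (q , s) , (d , mv) ∷ (m , mv) ∷ (d′ , stay) ∷ (m′ , stay) ∷ idle ss
  respond q true (d , m , _) _ ss (s , (d′ , m′ , _) , mv) =
    (q , s) , (d , stay) ∷ (m , stay) ∷ (d′ , mv) ∷ (m′ , mv) ∷ idle ss

  imitate : Bool → InputSymbol → (c c′ : Cell) → M.Q × Move × Vec (Symbol × Move) k → Q × Vec (Symbol × Move) (4 + k)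
  imitate beyond y (d , m , _) (d′ , m′ , _) (q , mᵢ , as) =
    (q , schedule beyond mᵢ y) , (d , stay) ∷ (m , stay) ∷ (d′ , stay) ∷ (m′ , stay) ∷ as

  active : ∀ {A : Set} → Bool → A → A → A
  active false x y = x
  active true  x y = y

  δ : Q → InputSymbol → Vec Symbol (4 + k) → Maybe (Q × Vec (Symbol × Move) (4 + k))
  δ (q , beyond , setup) y (d ∷ m ∷ d′ ∷ m′ ∷ ss) =
    just ((q , false , rest) , (𝟘 , right) ∷ (𝟙 , right) ∷ (𝟘 , right) ∷ (𝟙 , right) ∷ idle ss)
  δ (q , beyond , rest) y (d ∷ m ∷ d′ ∷ m′ ∷ ss) =
    Maybe.map (imitate beyond y (d , m , tt) (d′ , m′ , tt)) (M.δ q (seen beyond y) ss)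
  δ (q , beyond , count o) y (d ∷ m ∷ d′ ∷ m′ ∷ ss) =
    just (respond q beyond (d , m , tt) (d′ , m′ , tt) ss (operate beyond o (active beyond (d , m , tt) (d′ , m′ , tt))))

  accept : Q → Bool
  accept (q , _ , rest) = F q
  accept _              = false

  machine : RandomAccessTM
  machine = record
    { Q      = Q
    ; finite = M.finite ×-finite (bool-finite ×-finite (Fin-finite 2 ⊎-finite Fin-finite 5))
    ; q₀     = M.q₀ , false , setup
    ; F      = accept
    ; k      = 3 + k
    ; k≥1    = s≤s z≤n
    ; δ      = δ
    }
    where bool-finite = 2 , ↔-sym 2↔Bool

  open RandomAccessTM machine using (Configuration; config; next)

  tracks : Zipper Cell → Zipper Cell → Vec Tape k → Vec Tape (4 + k)
  tracks z z′ ts = track proj₁ z ∷ track (proj₁ ∘ proj₂) z ∷ track proj₁ z′ ∷ track (proj₁ ∘ proj₂) z′ ∷ ts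

  pair : Bool → Zipper Cell → Zipper Cell → Vec Tape k → Vec Tape (4 + k)
  pair false z z′ = tracks z z′
  pair true  z z′ = tracks z′ z

  embed : M.Q → State → Bool → Zipper Cell → Zipper Cell → Vec Tape k → Configuration
  embed q s beyond z z′ ts = config (q , s) (pair beyond z z′ ts)

  module On (w : List Bool) where

    open Runs (M.run w) using (_⇾_; _⇾*_)
    open Runs (RandomAccessTM.run machine w) using () renaming (_⇾_ to _⇾′_; _⇾*_ to _⇾′*_)

    operate-step : ∀ {o c c′ s m} q beyond l r z′ ts → operate beyond o c ≡ (s , c′ , m) →
      embed q (beyond , count o) beyond (zipper l c r) z′ ts ⇾′ embed q s beyond (moveZ blank m (zipper l c′ r)) z′ ts
    operate-step {o} {c} {m = m} q false l r z′ ts eq = (λ ()) , trans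
      (cong (λ α → just (RandomAccessTM.perform machine (pair false (zipper l c r) z′ ts)
        (respond q false c (Zipper.scanned z′) (scan ts) α))) eq)
      (cong (just ∘ config _) (cong₂ _∷_ (act-track proj₁ refl m (zipper l c r))
        (cong₂ _∷_ (act-track (proj₁ ∘ proj₂) refl m (zipper l c r)) (cong₂ _∷_ refl (cong₂ _∷_ refl (act-idle ts))))))
    operate-step {o} {c} {m = m} q true l r z′ ts eq = (λ ()) , trans
      (cong (λ α → just (RandomAccessTM.perform machine (pair true (zipper l c r) z′ ts)
        (respond q true (Zipper.scanned z′) c (scan ts) α))) eq)
      (cong (just ∘ config _) (cong₂ _∷_ refl (cong₂ _∷_ refl (cong₂ _∷_ (act-track proj₁ refl m (zipper l c r))
        (cong₂ _∷_ (act-track (proj₁ ∘ proj₂) refl m (zipper l c r)) (act-idle ts))))))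

    ticks : ∀ {o o′ z y} q beyond z′ ts → Star _↝_ (o , z) (o′ , y) →
      embed q (beyond , count o) beyond z z′ ts ⇾′* embed q (beyond , count o′) beyond y z′ ts
    ticks q beyond z′ ts = Star.gmap (λ (o , z) → embed q (beyond , count o) beyond z z′ ts)
      λ { (tick eq refl) → operate-step q beyond _ _ z′ ts (cong (counting beyond _) eq) }

    -- Each new bit of a counter is owed to a position that the head has reached.
    Reached : ℕ → Set
    Reached p = ∃[ c ] M.initial ⇾* c × p ≤ suc (M.Configuration.inputHead c)

    record Register : Set where
      field
        {tags} : List Load
        marked  : Marked tags
        reached : Reached (2 ^ (length tags ∸ 1))
        bits    : Vec Bool (length tags)
      stored : Zipper Cell
      stored = zipper (cells tags bits) blank []
      value : ℕ
      value = val bits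

    open Register

    increment : ∀ X q beyond z′ ts → Reached (suc (value X)) → ∃[ Y ] value Y ≡ suc (value X) ×
      embed q (beyond , count carry) beyond (stored X) z′ ts ⇾′* embed q (beyond , rest) beyond (stored Y) z′ ts
    increment record { tags = v ∷ vs ; marked = M ; reached = R ; bits = bs } q beyond z′ ts (e , ρ , h)
      with inc bs in eq | increment-run {tt} M bs []
    ... | false , bs′ | σ = record { marked = M ; reached = R ; bits = bs′ } , inc-val bs eq ,
      ticks q beyond z′ ts σ ◅◅ operate-step q beyond _ _ z′ ts refl ◅ ε
    -- The new number of bits less one is the old number, and two to that power is at most the
    -- incremented value, which the given `Reached` covers.
    ... | true  , bs′ | σ with p , h′ ← inc-overflow bs eq =
      record { marked = tt ∷ M ; reached = e , ρ , ≤-trans (*-monoʳ-≤ 2 h′) (≤-trans (≤-reflexive p) h)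
             ; bits = false ∷ bs′ } ,
      p , ticks q beyond z′ ts σ ◅◅ operate-step q beyond _ _ z′ ts refl ◅ ε

    decrement : ∀ X q beyond z′ ts → ∃[ Y ] ∃[ s ]
      embed q (beyond , count borrow) beyond (stored X) z′ ts ⇾′* embed q (s , rest) beyond (stored Y) z′ ts ×
      (value X ≡ 0 × value Y ≡ 0 × s ≡ false ⊎ value X ≡ suc (value Y) × s ≡ beyond)
    decrement record { tags = v ∷ vs ; marked = M ; reached = R ; bits = bs } q beyond z′ ts
      with dec bs in eq | decrement-run (tt ∷ M) bs []
    ... | nothing  | σ = record { marked = M ; reached = R ; bits = replicate _ false } , false ,
      ticks q beyond z′ ts σ ◅◅ operate-step q beyond _ _ z′ ts refl ◅ ε ,
      inj₁ (dec-nothing bs eq , val-zeros (suc (length vs)) , refl)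
    ... | just bs′ | σ = record { marked = M ; reached = R ; bits = bs′ } , beyond ,
      ticks q beyond z′ ts σ ◅◅ operate-step q beyond _ _ z′ ts refl ◅ ε , inj₂ (dec-just bs eq , refl)

    data Position (a d i : ℕ) : Bool → Set where
      inside : d ≡ 0 → a ≡ i → i ≤ length w → Position a d i false
      beyond : a ≡ length w → i ≡ suc (length w + d) → Position a d i true

    data Related : M.Configuration → Configuration → Set where
      related : ∀ {q i ts s} A D → Position (value A) (value D) i s →
        Related (M.config q i ts) (config (q , s , rest) (tracks (stored A) (stored D) ts))

    reads : ∀ X → readBinary (Tape.contents (track proj₁ (stored X))) ≡ value X
    reads X = go {tags X} {␣ ∷ []} (bits X)
      where
      go : ∀ {vs s} (bs : Vec Bool (length vs)) → readBinary (map proj₁ (cells vs bs) ʳ++ s) ≡ readFrom (val bs) s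
      go {[]}         []       = refl
      go {v ∷ vs} {s} (b ∷ bs) = trans (go {vs} {bit b ∷ s} bs) (readFrom-bit b bs s)

    sees : ∀ {a d i s} → Position a d i s → seen s (randomAccess w a) ≡ inputCell w i
    sees (inside _ refl h) = sym (inputCell≡randomAccess w _ h)
    sees (beyond _ refl)   = sym (inputCell-beyond w _ (s≤s (m≤m+n (length w) _)))

    step-rest : ∀ {q q′ s mᵢ as} A D ts → M.δ q (seen s (randomAccess w (value A))) (scan ts) ≡ just (q′ , mᵢ , as) →
      next w (config (q , s , rest) (tracks (stored A) (stored D) ts)) ≡
      just (config (q′ , schedule s mᵢ (randomAccess w (value A))) (tracks (stored A) (stored D) (actAll as ts)))
    step-rest {q} {s = s} A D ts eq rewrite reads A | eq = refl

    proceed : ∀ {q ts s a d i} A D mᵢ → value A ≡ a → value D ≡ d → Position a d i s →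
      Reached (moveInput mᵢ i) →
      ∃[ c′ ] config (q , schedule s mᵢ (randomAccess w a)) (tracks (stored A) (stored D) ts) ⇾′* c′ ×
        Related (M.config q (moveInput mᵢ i) ts) c′
    proceed {q} {ts} A D left refl refl (inside eq refl h) R with decrement A q false (stored D) ts
    ... | A′ , s , σ , inj₁ (p , p′ , refl) = _ , σ ,
      related A′ D (inside eq (trans p′ (cong pred (sym p))) (≤-trans (pred[n]≤n) h))
    ... | A′ , s , σ , inj₂ (p , refl) = _ , σ , related A′ D (inside eq (cong pred (sym p)) (≤-trans pred[n]≤n h))
    proceed {q} {ts} A D right refl refl (inside eq refl h) R
      with randomAccess w (value A) in y≡ | m≤n⇒m<n∨m≡n h
    ... | ◁     | inj₁ lt = contradiction (trans (sym y≡) (proj₂ (randomAccess-bit w _ lt))) λ ()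
    ... | ◁     | inj₂ e  = _ , ε , related A D (beyond e (cong suc (trans (sym (+-identityʳ _)) (sym (cong₂ _+_ (sym e) eq)))))
    ... | ⌞ _ ⌟ | inj₂ e  = contradiction (trans (sym y≡) (trans (cong (randomAccess w) e) (randomAccess-end w))) λ ()
    ... | ⌞ _ ⌟ | inj₁ lt with A′ , p , σ ← increment A q false (stored D) ts R =
      _ , σ , related A′ D (inside eq p lt)
    proceed {q} {ts} A D stay refl refl π@(inside _ _ _) R = _ , ε , related A D π
    proceed {q} {ts} A D left refl refl (beyond eq refl) R with decrement D q true (stored A) ts
    ... | D′ , s , σ , inj₁ (p , p′ , refl) = _ , σ ,
      related A D′ (inside p′ (trans eq (sym (trans (cong (length w +_) p) (+-identityʳ _))))
        (≤-reflexive (trans (cong (length w +_) p) (+-identityʳ _))))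
    ... | D′ , s , σ , inj₂ (p , refl) = _ , σ , related A D′ (beyond eq (trans (cong (length w +_) p) (+-suc _ _)))
    proceed {q} {ts} A D right refl refl (beyond eq refl) (e , ρ , h)
      with D′ , p , σ ← increment D q true (stored A) ts (e , ρ , ≤-trans (s≤s (m≤n⇒m≤1+n (m≤n+m (value D) (length w)))) h) =
      _ , σ , related A D′ (beyond eq (cong suc (trans (sym (+-suc (length w) (value D))) (cong (length w +_) (sym p)))))
    proceed {q} {ts} A D stay refl refl π@(beyond _ _) R = _ , ε , related A D π

    advance : ∀ {c c′ d} → M.initial ⇾* c → Related c c′ → c ⇾ d → ∃[ d′ ] c′ ⇾′* d′ × Related d d′
    advance ρ (related {q} {i} {ts} {s} A D π) (¬acc , e) with M.δ q (inputCell w i) (scan ts) in δ≡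
    advance ρ (related {q} {i} {ts} {s} A D π) (¬acc , refl) | just (q′ , mᵢ , as)
      with c′ , σ , r ← proceed {q′} {actAll as ts} A D mᵢ refl refl π
             (_ , ρ ◅◅ (¬acc , cong (Maybe.map (M.perform i ts)) δ≡) ◅ ε , n≤1+n _) =
      c′ , (¬acc , step-rest A D ts (trans (cong (λ y → M.δ q y (scan ts)) (sees π)) δ≡)) ◅ σ , r

    halt : ∀ {c c′} → Related c c′ → M.next w c ≡ nothing → next w c′ ≡ nothing
    halt (related {q} {i} {ts} {s} A D π) e with M.δ q (inputCell w i) (scan ts) in δ≡
    ... | nothing rewrite reads A | sees π | δ≡ = refl

    zero-register : Register
    zero-register = record
      -- The first bit is owed to position 0; the `suc` in `Reached` makes room for it.
      { marked = leftmost {tt} ; reached = _ , ε , s≤s z≤n ; bits = false ∷ [] }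

    launch : ∃[ c′ ] RandomAccessTM.initial machine ⇾′* c′ × Related M.initial c′
    launch = _ , ((λ ()) , cong (just ∘ config _)
      (cong (λ ts → _ ∷ _ ∷ _ ∷ _ ∷ ts) (act-idle (replicate k blankTape)))) ◅ ε ,
      related zero-register zero-register (inside refl refl z≤n)

    simulation : Simulation (M.run w) (RandomAccessTM.run machine w)
    simulation = record
      { R       = Related
      ; launch  = launch
      ; advance = advance
      ; halt    = halt
      ; agree   = λ { (related _ _ _) → refl }
      }

    length-cells : ∀ vs bs → length (cells vs bs) ≡ length vs
    length-cells []       []       = refl
    length-cells (v ∷ vs) (b ∷ bs) = cong suc (length-cells vs bs)

    -- A width of l bits was charged to a position of at least 2^(l-1) - 1. As every position is
    -- below 2^e, l is at most e + 1, and the blank under the head is one more cell.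
    fits-register : ∀ {e} → (∀ {c} → M.initial ⇾* c → M.Configuration.inputHead c < 2 ^ e) →
      ∀ X f → size (track f (stored X)) ≤ e + 2
    fits-register {e} H X f with c , ρ , h ← reached X = begin
      size (track f (stored X))              ≡⟨ size-track f (stored X) ⟩
      length (cells (tags X) (bits X)) + 1   ≡⟨ cong (_+ 1) (length-cells (tags X) (bits X)) ⟩
      length (tags X) + 1                    ≤⟨ +-monoˡ-≤ 1 (m≤n+m∸n (length (tags X)) 1) ⟩
      suc (length (tags X) ∸ 1) + 1          ≤⟨ +-monoˡ-≤ 1 (s≤s (≮⇒≥ λ e< → <⇒≱ (^-monoʳ-< 2 (s≤s (s≤s z≤n)) e<) (≤-trans h (H ρ)))) ⟩
      suc e + 1                              ≡⟨ sym (+-suc e 1) ⟩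
      e + 2                                  ∎
      where open ≤-Reasoning

    fits-related : ∀ {b e c c′} → (∀ {c} → M.initial ⇾* c → M.Configuration.inputHead c < 2 ^ e) →
      Related c c′ → Fits b (M.Configuration.tapes c) → Fits (b + (e + 2)) (Configuration.tapes c′)
    fits-related {b} {e} H (related A D π) hs = fits A proj₁ VecAll.∷ fits A _ VecAll.∷ fits D proj₁ VecAll.∷ fits D _ VecAll.∷
      VecAll.map (λ h → ≤-trans h (m≤m+n b (e + 2))) hs
      where
      fits : ∀ X f → size (track f (stored X)) ≤ b + (e + 2)
      fits X f = ≤-trans (fits-register {e} H X f) (m≤n+m (e + 2) b)

    module Source = StandardSpace M w
    module Target = RandomAccessSpace machine w
    open InputHead M w using (configurations; inputHead≤)

    visits : ∀ {b e a f} → suc (length w + configurations b) ≤ 2 ^ e → Ends (M.run w) a f →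
      VisitsAtMost (M.run w) b → VisitsAtMost (RandomAccessTM.run machine w) (b + (e + 2))
    visits {b} {e} h E V with f′ , E′ , r ← Simulation.transfer simulation E =
      Target.ends⇒visits E′ (fits-related (λ ρ → ≤-trans (s≤s (inputHead≤ E fits ρ)) h) r (fits (proj₁ E)))
      where
      fits : ∀ {c} → M.initial ⇾* c → Fits b (M.Configuration.tapes c)
      fits = Source.visits⇒fits V (blank-fits k M.k≥1 (V ε))
        where
        blank-fits : ∀ k → k ≥ 1 →
          All (_< b) (Vec.toList (Vec.map Tape.position (replicate k blankTape))) → Fits b (replicate k blankTape)
        blank-fits k@(suc _) _ (0<b ∷ _) = fits-blank k 0<b


-- Exponential bounds on head positions, and the conclusion

n≤2^⌈log₂n⌉ : ∀ n → n ≤ 2 ^ ⌈log₂ n ⌉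
n≤2^⌈log₂n⌉ = <-rec _ bound
  where
  bound : ∀ n → (∀ {m} → m < n → m ≤ 2 ^ ⌈log₂ m ⌉) → n ≤ 2 ^ ⌈log₂ n ⌉
  bound 0 ih = z≤n
  bound 1 ih = ≤-refl
  bound n@(suc (suc m)) ih = begin
    n                                ≡⟨ ⌊n/2⌋+⌈n/2⌉≡n n ⟨
    ⌊ n /2⌋ + ⌈ n /2⌉                ≤⟨ +-monoˡ-≤ ⌈ n /2⌉ (⌊n/2⌋≤⌈n/2⌉ n) ⟩
    ⌈ n /2⌉ + ⌈ n /2⌉                ≡⟨ cong (⌈ n /2⌉ +_) (+-identityʳ _) ⟨
    2 * ⌈ n /2⌉                      ≤⟨ *-monoʳ-≤ 2 (ih (⌈n/2⌉<n m)) ⟩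
    2 ^ suc ⌈log₂ ⌈ n /2⌉ ⌉          ≡⟨ cong (λ l → 2 ^ suc l) (⌈log₂⌈n/2⌉⌉≡⌈log₂n⌉∸1 n) ⟩
    2 ^ suc (⌈log₂ n ⌉ ∸ 1)          ≡⟨ cong (2 ^_) (m+[n∸m]≡n (1≤⌈log₂⌉ {n} (s≤s (s≤s z≤n)))) ⟩
    2 ^ ⌈log₂ n ⌉                    ∎
    where open ≤-Reasoning

n≤2^n : ∀ n → n ≤ 2 ^ n
n≤2^n zero    = z≤n
n≤2^n (suc n) = ≤-trans (+-mono-≤ (m^n>0 2 n) (n≤2^n n)) (≤-reflexive (cong (2 ^ n +_) (sym (+-identityʳ (2 ^ n)))))

tapeCount^ : ∀ b k → tapeCount b ^ k ≡ 2 ^ (4 * b * k)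
tapeCount^ b k = begin
  (4 ^ b * 4 ^ b) ^ k        ≡⟨ cong (_^ k) (^-distribˡ-+-* 4 b b) ⟨
  (4 ^ (b + b)) ^ k          ≡⟨ cong (_^ k) (^-*-assoc 2 2 (b + b)) ⟩
  (2 ^ (2 * (b + b))) ^ k    ≡⟨ ^-*-assoc 2 (2 * (b + b)) k ⟩
  2 ^ (2 * (b + b) * k)      ≡⟨ cong (λ x → 2 ^ (x * k)) (double-sum b) ⟩
  2 ^ (4 * b * k)            ∎
  where
  open ≡-Reasoning
  double-sum : ∀ b → 2 * (b + b) ≡ 4 * b
  double-sum = solve-∀

2^+2^≤ : ∀ x y → suc (2 ^ x + 2 ^ y) ≤ 2 ^ (2 + (x + y))
2^+2^≤ x y = begin
  1 + (2 ^ x + 2 ^ y)                     ≤⟨ +-mono-≤ (m^n>0 2 z) (+-mono-≤ (^-monoʳ-≤ 2 (m≤m+n x y)) (^-monoʳ-≤ 2 (m≤n+m y x))) ⟩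
  2 ^ z + (2 ^ z + 2 ^ z)                 ≤⟨ m≤n+m _ (2 ^ z) ⟩
  2 ^ z + (2 ^ z + (2 ^ z + 2 ^ z))       ≡⟨ fourfold (2 ^ z) ⟩
  2 ^ (2 + z)                             ∎
  where
  open ≤-Reasoning
  z = x + y
  fourfold : ∀ n → n + (n + (n + n)) ≡ 2 * (2 * n)
  fourfold = solve-∀

module _ {σ : Vocabulary} {ℓ} {𝒞 : Pred (OrderedStructure σ) ℓ} where

  standard⇒randomAccess : StandardDecidable 𝒞 → RandomAccessDecidable 𝒞
  standard⇒randomAccess (M , D) = machine , simulated (On.simulation) D (space′ space)
    where
    open Addressed M
    open DecidesInPolylogSpace D
    m = proj₁ (StandardTM.finite M)
    k = StandardTM.k M

    -- A logarithmic bound for the head positions: `L` for the input length, `m` for the states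
    -- since m ≤ 2^m, `4 * b * k` for `k` tapes with at most 4^b * 4^b contents each, and 2 for
    -- merging the sum of powers into one power.
    exponent : ℕ → ℕ → ℕ
    exponent L b = 2 + (L + (m + 4 * b * k))

    heads : ∀ w b → suc (length w + InputHead.configurations M w b) ≤ 2 ^ exponent ⌈log₂ length w ⌉ b
    heads w b = ≤-trans (s≤s (+-mono-≤ (n≤2^⌈log₂n⌉ (length w)) (begin
      m * tapeCount b ^ k         ≤⟨ *-mono-≤ (n≤2^n m) (≤-reflexive (tapeCount^ b k)) ⟩
      2 ^ m * 2 ^ (4 * b * k)     ≡⟨ ^-distribˡ-+-* 2 m (4 * b * k) ⟨
      2 ^ (m + 4 * b * k)         ∎))) (2^+2^≤ ⌈log₂ length w ⌉ (m + 4 * b * k))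
      where open ≤-Reasoning

    polylog : ∀ L κ c → 1 ≤ L → let b = c * L ^ κ in
      b + (exponent L b + 2) ≤ (c + 5 + m + 4 * c * k) * L ^ suc κ
    polylog L κ c 1≤L = begin
      b + (exponent L b + 2)                                 ≡⟨ regroup b L m k ⟩
      b + L + 4 * 1 + m * 1 + 4 * b * k                      ≤⟨ +-mono-≤ (+-mono-≤ (+-mono-≤ (+-mono-≤ b≤ L≤) (*-monoʳ-≤ 4 1≤)) (*-monoʳ-≤ m 1≤))
                                                                  (*-monoˡ-≤ k (*-monoʳ-≤ 4 b≤)) ⟩
      c * P + P + 4 * P + m * P + 4 * (c * P) * k            ≡⟨ collect c P m k ⟩
      (c + 5 + m + 4 * c * k) * P                            ∎
      where
      open ≤-Reasoning
      b = c * L ^ κ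
      P = L ^ suc κ
      instance _ = >-nonZero 1≤L
      1≤ : 1 ≤ P
      1≤ = m^n>0 L (suc κ)
      L≤ : L ≤ P
      L≤ = m≤m*n L (L ^ κ) {{m^n≢0 L κ}}
      b≤ : b ≤ c * P
      b≤ = *-monoʳ-≤ c (m≤n*m (L ^ κ) L)
      regroup : ∀ b L m k → b + (2 + (L + (m + 4 * b * k)) + 2) ≡ b + L + 4 * 1 + m * 1 + 4 * b * k
      regroup = solve-∀
      collect : ∀ c P m k → c * P + P + 4 * P + m * P + 4 * (c * P) * k ≡ (c + 5 + m + 4 * c * k) * P
      collect = solve-∀

    space′ : SpaceBounded σ (StandardTM.run M) → SpaceBounded σ (RandomAccessTM.run machine)
    -- The exponent contains `L` itself, which `L ^ κ` does not dominate when `κ` is 0; hence one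
    -- degree more.
    space′ (κ , c , N , V) = suc κ , c + 5 + m + 4 * c * k , N + 2 , λ 𝐀 h →
      let L = ⌈log₂ n̂ 𝐀 ⌉
          b = c * L ^ κ
      in VisitsAtMost-mono (polylog L κ c (1≤⌈log₂⌉ (≤-trans (m≤n+m 2 N) h)))
           (On.visits (bin 𝐀) {b} {exponent L b} (heads (bin 𝐀) b)
             (proj₂ (proj₂ (total⇒ends (StandardTM.run M (bin 𝐀)) (total 𝐀))))
        (V 𝐀 (≤-trans (m≤m+n N 2) h)))

proposition2 : ∀ {ℓ : Level} (σ : Vocabulary) (𝒞 : Pred (OrderedStructure σ) ℓ) →
    RandomAccessDecidable 𝒞 ⇔ StandardDecidable 𝒞
proposition2 σ 𝒞 = mk⇔ randomAccess⇒standard standard⇒randomAccess
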